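{- Let $M$ be a matroid of rank $r$ on a finite set $E$ and let $P_M$ be its matroid polytope. Then, as a signed Minkowski sum, \[P_M=\sum_{A\subseteq E}\widetilde{\beta}(M/A)\,\Delta_{E-A},\] i.e. $P_M+\sum_{A:\,\widetilde\beta(M/A)<0}(-\widetilde\beta(M/A))\Delta_{E-A}=\sum_{A:\,\widetilde\beta(M/A)>0}\widetilde\beta(M/A)\Delta_{E-A}$ (terms with coefficient $0$ omitted; the term $A=E$ always has coefficient $0$).
   Context: The matroid polytope $P_M\subseteq\mathbb{R}^E$ is the convex hull of the indicator vectors $\sum_{i\in B}e_i$ of the bases $B$ of $M$. For nonempty $J\subseteq E$, $\Delta_J=\mathrm{conv}\{e_i:i\in J\}$. For $A\subseteq E$, $M/A$ is the contraction, a matroid on $E-A$ with rank function $r_{M/A}(X)=r(X\cup A)-r(A)$. The beta invariant of a matroid $N$ on ground set $S$ with rank function $r_N$ is $\beta(N)=(-1)^{r_N(S)}\sum_{X\subseteq S}(-1)^{|X|}r_N(X)$, and the signed beta invariant is $\widetilde\beta(N)=(-1)^{r_N(S)+1}\beta(N)$. Minkowski sum: $P+Q=\{p+q\}$, $yQ=\{yq\}$ for $y\ge 0$.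
   Formalization: The polytopes P_M and Δ_{E−A} and their Minkowski sums are taken as sets of points with rational coordinates in place of subsets of ℝ^E; that the term A=E has coefficient 0 is proved separately, not as part of the statement. -}

module Defs where

open import Data.Nat as ℕ using (ℕ; zero; suc)
open import Data.Integer as ℤ using (ℤ; +_)
open import Data.Rational as ℚ using (ℚ; 0ℚ; 1ℚ)
open import Data.Fin using (Fin)
open import Data.Fin.Subset using (Subset; _⊆_; _∪_; _∩_; ⊥; ⊤; ∁; ∣_∣; _∈_; _∉_; inside; outside)
open import Data.Fin.Subset.Properties using (_⊆?_; _∈?_)
open import Data.Bool using (Bool; true; false; if_then_else_)
open import Data.Vec using (Vec; []; _∷_)
open import Data.List using (List; []; _∷_; map; filter; foldr; length; lookup)
open import Data.Product using (Σ; _×_; ∃; _,_)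
open import Relation.Binary.PropositionalEquality using (_≡_)
open import Relation.Nullary using (Dec; yes; no; does)

record Matroid (n : ℕ) : Set where
  field
    rank       : Subset n → ℕ
    rank-bound : ∀ X → rank X ℕ.≤ ∣ X ∣
    rank-mono  : ∀ X Y → X ⊆ Y → rank X ℕ.≤ rank Y
    rank-submod : ∀ X Y → rank (X ∪ Y) ℕ.+ rank (X ∩ Y) ℕ.≤ rank X ℕ.+ rank Y
open Matroid public

subsets : (n : ℕ) → List (Subset n)
subsets zero = [] ∷ []
subsets (suc n) = map (outside ∷_) (subsets n) Data.List.++ map (inside ∷_) (subsets n)

IsBasis : ∀ {n} → Matroid n → Subset n → Set
IsBasis M B = (rank M B ≡ ∣ B ∣) × (rank M B ≡ rank M ⊤)

isBasis? : ∀ {n} (M : Matroid n) (B : Subset n) → Dec (IsBasis M B)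
isBasis? M B with rank M B ℕ.≟ ∣ B ∣ | rank M B ℕ.≟ rank M ⊤
... | yes p | yes q = yes (p , q)
... | no ¬p | _ = no (λ { (p , _) → ¬p p })
... | yes _ | no ¬q = no (λ { (_ , q) → ¬q q })

bases : ∀ {n} → Matroid n → List (Subset n)
bases {n} M = filter (isBasis? M) (subsets n)

-- Beta invariant of a matroid given by a rank function ρ on a ground set
-- S ⊆ Fin n (ρ only evaluated on subsets of S).

negOnePow : ℕ → ℤ
negOnePow zero = + 1
negOnePow (suc k) = ℤ.- negOnePow k

sumℤ : List ℤ → ℤ
sumℤ = foldr ℤ._+_ (+ 0)

beta : ∀ {n} (S : Subset n) (ρ : Subset n → ℤ) (rS : ℕ) → ℤ
beta {n} S ρ rS =
  negOnePow rS ℤ.* sumℤ (map (λ X → negOnePow ∣ X ∣ ℤ.* ρ X) (filter (_⊆? S) (subsets n)))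

contrGround : ∀ {n} → Subset n → Subset n
contrGround A = ∁ A

contrRank : ∀ {n} → Matroid n → Subset n → Subset n → ℤ
contrRank M A X = + rank M (X ∪ A) ℤ.- + rank M A

contrTotalRank : ∀ {n} → Matroid n → Subset n → ℕ
contrTotalRank M A = rank M ⊤ ℕ.∸ rank M A

betaContr : ∀ {n} → Matroid n → Subset n → ℤ
betaContr M A = beta (contrGround A) (contrRank M A) (contrTotalRank M A)

signedBetaContr : ∀ {n} → Matroid n → Subset n → ℤ
signedBetaContr M A = negOnePow (suc (contrTotalRank M A)) ℤ.* betaContr M A

Point : ℕ → Set
Point n = Fin n → ℚ

PointSet : ℕ → Set₁
PointSet n = Point n → Set

_≐_ : ∀ {n} → PointSet n → PointSet n → Set
P ≐ Q = ∀ x → (P x → Q x) × (Q x → P x)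

sumℚ : ∀ {k} → (Fin k → ℚ) → ℚ
sumℚ {zero} f = 0ℚ
sumℚ {suc k} f = f Fin.zero ℚ.+ sumℚ (λ i → f (Fin.suc i))
  where import Data.Fin as Fin

conv : ∀ {n} → List (Point n) → PointSet n
conv L x = Σ (Fin (length L) → ℚ) λ w →
  (∀ j → 0ℚ ℚ.≤ w j) × (sumℚ w ≡ 1ℚ) ×
  (∀ i → x i ≡ sumℚ (λ j → w j ℚ.* lookup L j i))

_⊕_ : ∀ {n} → PointSet n → PointSet n → PointSet n
(P ⊕ Q) x = Σ (Point _) λ p → Σ (Point _) λ q → P p × Q q × (∀ i → x i ≡ p i ℚ.+ q i)

_·_ : ∀ {n} → ℚ → PointSet n → PointSet n
(y · Q) x = Σ (Point _) λ q → Q q × (∀ i → x i ≡ y ℚ.* q i)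

zeroSet : ∀ {n} → PointSet n
zeroSet x = ∀ i → x i ≡ 0ℚ

minkSum : ∀ {n} → List (PointSet n) → PointSet n
minkSum = foldr _⊕_ zeroSet

indicator : ∀ {n} → Subset n → Point n
indicator X i = if does (i ∈? X) then 1ℚ else 0ℚ

unitVec : ∀ {n} → Fin n → Point n
unitVec i = indicator (Data.Fin.Subset.⁅ i ⁆)

allFin : (n : ℕ) → List (Fin n)
allFin n = Data.List.allFin n

matroidPolytope : ∀ {n} → Matroid n → PointSet n
matroidPolytope M = conv (map indicator (bases M))

simplex : ∀ {n} → Subset n → PointSet n
simplex {n} J = conv (map unitVec (filter (_∈? J) (allFin n)))

toℚ : ℤ → ℚ
toℚ z = z ℚ./ 1

negativePart : ∀ {n} → Matroid n → PointSet n
negativePart {n} M =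
  minkSum (map (λ A → toℚ (ℤ.- signedBetaContr M A) · simplex (∁ A))
               (filter (λ A → signedBetaContr M A ℤ.<? + 0) (subsets n)))

positivePart : ∀ {n} → Matroid n → PointSet n
positivePart {n} M =
  minkSum (map (λ A → toℚ (signedBetaContr M A) · simplex (∁ A))
               (filter (λ A → + 0 ℤ.<? signedBetaContr M A) (subsets n)))

{-# OPTIONS --safe #-}
module Submission where

-- For a submodular f with f ∅ = 0 let Base f = {x : x(S) ≤ f(S) for all S, x(E) = f(E)}.
-- The engine is Base f + Base g = Base (f + g): a point of the right-hand side is
-- split one coordinate at a time, and submodularity of f and g is exactly what makes
-- every lower bound for the next coordinate of the first summand at most every
-- upper bound.  The bounds are differences of the data, so integral data split integrally.
--
-- The simplex on E − A is Base of S ↦ [S ⊄ A], so both Minkowski sums of the theorem are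
-- base polytopes.  So is P_M: if x ∈ Base r and N x is integral, then N x splits into
-- N integral points of Base r, and these are indicator vectors of bases.  It
-- remains to compare functions, r(S) = Σ_A β̃(M/A) [S ⊄ A], which is Möbius inversion.

open import Defs
open import Data.Bool using (true; false; if_then_else_)
open import Data.Nat using (ℕ)
open import Data.Nat as ℕ using (zero; suc)
import Data.Nat.Properties as ℕ
open import Data.Integer as ℤ using (ℤ; -[1+_]; 0ℤ) renaming (+_ to pos)
import Data.Integer.Properties as ℤ
import Data.Integer.Solver as ℤ
open import Data.Fin using (Fin; zero; suc)
open import Data.Fin.Subset using (Subset; inside; outside; ⊥; ⊤; _∪_; _∩_; ∁; ⁅_⁆; _∈_; _∉_; _⊆_; ∣_∣; Nonempty)
open import Data.Fin.Subset.Properties using (_⊆?_; _∈?_; nonempty?; ∈⊤; x∉p⇒x∈∁p; x∈∁p⇒x∉p; x∈⁅y⁆⇒x≡y; x∈p∪q⁻; ⊆-trans; p∩q⊆p; p∩q⊆q; ⊥⊆; ∣⊥∣≡0; ∣⁅x⁆∣≡1; ∩-identityʳ; p∪∁p≡⊤; ∩-distribˡ-∪; ∩-idem; ∪-identityʳ; Empty-unique)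
open import Data.List using (List; []; _∷_; _++_; map; filter; length; lookup)
open import Data.List.Properties using (map-++; map-∘)
open import Data.List.Membership.Propositional using () renaming (_∈_ to _∈ˡ_)
open import Data.List.Membership.Propositional.Properties using (∈-map⁺; ∈-map⁻; ∈-filter⁺; ∈-filter⁻; ∈-++⁺ˡ; ∈-++⁺ʳ; ∈-allFin; ∈-lookup)
open import Data.List.Relation.Unary.All as All using (All; []; _∷_)
open import Data.List.Relation.Unary.All.Properties using (all-filter)
open import Data.List.Relation.Unary.Any using (here; index)
open import Data.List.Relation.Unary.Any.Properties using (lookup-index)
open import Data.Product using (Σ; ∃; _×_; _,_; proj₁; proj₂)
open import Data.Rational using (ℚ; 0ℚ; 1ℚ; mkℚ; _+_; _*_; _-_; -_; _≤_; _<_; _⊓_; 1/_; ↥_; ↧ₙ_; toℚᵘ; Positive; NonZero; positive; nonNegative)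
open import Data.Rational.Properties
import Data.Rational.Solver as ℚ
open import Data.Rational.Unnormalised as ℚᵘ using (mkℚᵘ; *≡*; *≤*; *<*)
import Data.Rational.Unnormalised.Properties as ℚᵘ
open import Data.Sum using (_⊎_; inj₁; inj₂; [_,_]′)
open import Data.Unit using (tt) renaming (⊤ to Unit)
open import Data.Vec using ([]; _∷_)
open import Function using (_∘_)
open import Relation.Binary using (tri<; tri≈; tri>)
open import Relation.Binary.PropositionalEquality
open import Relation.Nullary using (yes; no; does; contradiction)
open import Relation.Unary using (Decidable)
open ℚ.+-*-Solver using (solve; _:=_; _:+_; _:*_; _:-_; :-_; con)
module ℤS = ℤ.+-*-Solver

-- The equation says that `d - c` and `b - a` agree. Linear consequences of an inequality are
-- thereby reduced to a ring identity that the solver proves.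
≤-rearrange : ∀ {a b c d} → a ≤ b → a + d ≡ b + c → c ≤ d
≤-rearrange {a} {b} {c} {d} a≤b eq = begin
  c            ≡⟨ solve 2 (λ b c → c := (b :+ c) :- b) refl b c ⟩
  b + c - b    ≡⟨ cong (_- b) (sym eq) ⟩
  a + d - b    ≤⟨ +-monoˡ-≤ (- b) (+-monoˡ-≤ d a≤b) ⟩
  b + d - b    ≡⟨ solve 2 (λ b d → (b :+ d) :- b := d) refl b d ⟩
  d            ∎
  where open ≤-Reasoning

-- Weights of subsets and submodular set functions

weight : ∀ {n} → Point n → Subset n → ℚ
weight x []            = 0ℚ
weight x (outside ∷ S) = weight (x ∘ suc) S
weight x (inside ∷ S)  = x zero + weight (x ∘ suc) S

SetFun : ℕ → Set
SetFun n = Subset n → ℚ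

Submodular : ∀ {n} → SetFun n → Set
Submodular f = ∀ S T → f (S ∪ T) + f (S ∩ T) ≤ f S + f T

weight-⊥ : ∀ {n} (x : Point n) → weight x ⊥ ≡ 0ℚ
weight-⊥ {zero}  x = refl
weight-⊥ {suc n} x = weight-⊥ (x ∘ suc)

weight-modular : ∀ {n} (x : Point n) S T → weight x (S ∪ T) + weight x (S ∩ T) ≡ weight x S + weight x T
weight-modular x []            []            = refl
weight-modular x (outside ∷ S) (outside ∷ T) = weight-modular (x ∘ suc) S T
weight-modular x (outside ∷ S) (inside ∷ T)  = begin
  x zero + u + i    ≡⟨ +-assoc (x zero) u i ⟩
  x zero + (u + i)  ≡⟨ cong (x zero +_) (weight-modular (x ∘ suc) S T) ⟩
  x zero + (s + t)  ≡⟨ solve 3 (λ x s t → x :+ (s :+ t) := s :+ (x :+ t)) refl (x zero) s t ⟩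
  s + (x zero + t)  ∎
  where
  open ≡-Reasoning
  s = weight (x ∘ suc) S
  t = weight (x ∘ suc) T
  u = weight (x ∘ suc) (S ∪ T)
  i = weight (x ∘ suc) (S ∩ T)
weight-modular x (inside ∷ S)  (outside ∷ T) = begin
  x zero + u + i    ≡⟨ +-assoc (x zero) u i ⟩
  x zero + (u + i)  ≡⟨ cong (x zero +_) (weight-modular (x ∘ suc) S T) ⟩
  x zero + (s + t)  ≡⟨ sym (+-assoc (x zero) s t) ⟩
  x zero + s + t    ∎
  where
  open ≡-Reasoning
  s = weight (x ∘ suc) S
  t = weight (x ∘ suc) T
  u = weight (x ∘ suc) (S ∪ T)
  i = weight (x ∘ suc) (S ∩ T)
weight-modular x (inside ∷ S)  (inside ∷ T)  = begin
  x zero + u + (x zero + i)    ≡⟨ solve 3 (λ x u i → (x :+ u) :+ (x :+ i) := (x :+ x) :+ (u :+ i)) refl (x zero) u i ⟩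
  x zero + x zero + (u + i)    ≡⟨ cong (x zero + x zero +_) (weight-modular (x ∘ suc) S T) ⟩
  x zero + x zero + (s + t)    ≡⟨ solve 3 (λ x u i → (x :+ x) :+ (u :+ i) := (x :+ u) :+ (x :+ i)) refl (x zero) s t ⟩
  x zero + s + (x zero + t)    ∎
  where
  open ≡-Reasoning
  s = weight (x ∘ suc) S
  t = weight (x ∘ suc) T
  u = weight (x ∘ suc) (S ∪ T)
  i = weight (x ∘ suc) (S ∩ T)

-- Supplies the largest of the finitely many lower bounds from which `decompose` takes its next
-- coordinate.
maximiser : ∀ {n} (φ : SetFun n) → ∃ λ S → ∀ T → φ T ≤ φ S
maximiser {zero}  φ = [] , λ { [] → ≤-refl }
maximiser {suc n} φ with maximiser (φ ∘ (outside ∷_)) | maximiser (φ ∘ (inside ∷_))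
... | S₀ , max₀ | S₁ , max₁ with ≤-total (φ (outside ∷ S₀)) (φ (inside ∷ S₁))
... | inj₁ 0≤1 = inside ∷ S₁ , λ { (outside ∷ T) → ≤-trans (max₀ T) 0≤1 ; (inside ∷ T) → max₁ T }
... | inj₂ 1≤0 = outside ∷ S₀ , λ { (outside ∷ T) → max₀ T ; (inside ∷ T) → ≤-trans (max₁ T) 1≤0 }

-- The constraints that f imposes on the remaining coordinates once the
-- first one has been fixed to be a.
fix : ∀ {n} → SetFun (suc n) → ℚ → SetFun n
fix f a S = f (outside ∷ S) ⊓ (f (inside ∷ S) - a)

fix-≤-out : ∀ {n} (f : SetFun (suc n)) a S → fix f a S ≤ f (outside ∷ S)
fix-≤-out f a S = p⊓q≤p (f (outside ∷ S)) (f (inside ∷ S) - a)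

fix-≤-in : ∀ {n} (f : SetFun (suc n)) a S → fix f a S ≤ f (inside ∷ S) - a
fix-≤-in f a S = p⊓q≤q (f (outside ∷ S)) (f (inside ∷ S) - a)

-- Look at which branch attains the minimum at `S` and at `T`. At the union take the inside branch
-- if either does, at the intersection only if both do. Then `a` is subtracted equally often on both
-- sides, and a single instance of submodularity of `f` remains.
fix-submodular : ∀ {n} (f : SetFun (suc n)) a → Submodular f → Submodular (fix f a)
fix-submodular f a sub S T
  with ⊓-sel (f (outside ∷ S)) (f (inside ∷ S) - a) | ⊓-sel (f (outside ∷ T)) (f (inside ∷ T) - a)
... | inj₁ e | inj₁ e′ rewrite e | e′ =
  ≤-trans (+-mono-≤ (fix-≤-out f a (S ∪ T)) (fix-≤-out f a (S ∩ T))) (sub (outside ∷ S) (outside ∷ T))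
... | inj₁ e | inj₂ e′ rewrite e | e′ =
  ≤-trans (+-mono-≤ (fix-≤-in f a (S ∪ T)) (fix-≤-out f a (S ∩ T)))
    (≤-rearrange (sub (outside ∷ S) (inside ∷ T))
      (solve 5 (λ u i s t a → (u :+ i) :+ (s :+ (t :- a)) := (s :+ t) :+ ((u :- a) :+ i)) refl
        (f (inside ∷ S ∪ T)) (f (outside ∷ S ∩ T)) (f (outside ∷ S)) (f (inside ∷ T)) a))
... | inj₂ e | inj₁ e′ rewrite e | e′ =
  ≤-trans (+-mono-≤ (fix-≤-in f a (S ∪ T)) (fix-≤-out f a (S ∩ T)))
    (≤-rearrange (sub (inside ∷ S) (outside ∷ T))
      (solve 5 (λ u i s t a → (u :+ i) :+ ((s :- a) :+ t) := (s :+ t) :+ ((u :- a) :+ i)) refl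
        (f (inside ∷ S ∪ T)) (f (outside ∷ S ∩ T)) (f (inside ∷ S)) (f (outside ∷ T)) a))
... | inj₂ e | inj₂ e′ rewrite e | e′ =
  ≤-trans (+-mono-≤ (fix-≤-in f a (S ∪ T)) (fix-≤-in f a (S ∩ T)))
    (≤-rearrange (sub (inside ∷ S) (inside ∷ T))
      (solve 5 (λ u i s t a → (u :+ i) :+ ((s :- a) :+ (t :- a)) := (s :+ t) :+ ((u :- a) :+ (i :- a))) refl
        (f (inside ∷ S ∪ T)) (f (inside ∷ S ∩ T)) (f (inside ∷ S)) (f (inside ∷ T)) a))

-- The bound on `a` says that the inside branch is nonnegative at `⊥`, so the minimum there is the
-- outside branch.
fix-⊥ : ∀ {n} (f : SetFun (suc n)) a → f ⊥ ≡ 0ℚ → a ≤ f (inside ∷ ⊥) → fix f a ⊥ ≡ 0ℚ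
fix-⊥ f a f⊥ a≤ = trans (p≤q⇒p⊓q≡p (subst (_≤ f (inside ∷ ⊥) - a) (sym f⊥)
  (≤-rearrange a≤ (solve 2 (λ a b → a :+ (b :- a) := b :+ con 0ℚ) refl a (f (inside ∷ ⊥)))))) f⊥

fix-inside : ∀ {n} (f : SetFun (suc n)) a {b} S → b ≤ fix f a S → a + b ≤ f (inside ∷ S)
fix-inside f a {b} S b≤ = ≤-rearrange (≤-trans b≤ (fix-≤-in f a S))
  (solve 3 (λ a b c → b :+ c := (c :- a) :+ (a :+ b)) refl a b (f (inside ∷ S)))

-- Finite sums, indicator vectors and their weights

sum-cong : ∀ {k} {f g : Fin k → ℚ} → (∀ i → f i ≡ g i) → sumℚ f ≡ sumℚ g
sum-cong {zero}  eq = refl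
sum-cong {suc k} eq = cong₂ _+_ (eq zero) (sum-cong (eq ∘ suc))

sum-0 : ∀ k → sumℚ {k} (λ _ → 0ℚ) ≡ 0ℚ
sum-0 zero    = refl
sum-0 (suc k) = trans (+-identityˡ _) (sum-0 k)

+-interchange : ∀ a b c d → (a + b) + (c + d) ≡ (a + c) + (b + d)
+-interchange = solve 4 (λ a b c d → (a :+ b) :+ (c :+ d) := (a :+ c) :+ (b :+ d)) refl

sum-+ : ∀ {k} (f g : Fin k → ℚ) → sumℚ (λ i → f i + g i) ≡ sumℚ f + sumℚ g
sum-+ {zero}  f g = refl
sum-+ {suc k} f g = trans (cong (f zero + g zero +_) (sum-+ (f ∘ suc) (g ∘ suc)))
  (+-interchange (f zero) (g zero) (sumℚ (f ∘ suc)) (sumℚ (g ∘ suc)))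

sum-* : ∀ {k} c (f : Fin k → ℚ) → sumℚ (λ i → c * f i) ≡ c * sumℚ f
sum-* {zero}  c f = sym (*-zeroʳ c)
sum-* {suc k} c f = trans (cong (c * f zero +_) (sum-* c (f ∘ suc))) (sym (*-distribˡ-+ c (f zero) _))

sum-mono : ∀ {k} {f g : Fin k → ℚ} → (∀ i → f i ≤ g i) → sumℚ f ≤ sumℚ g
sum-mono {zero}  le = ≤-refl
sum-mono {suc k} le = +-mono-≤ (le zero) (sum-mono (le ∘ suc))

*-monoˡ-≤ : ∀ {c a b} → 0ℚ ≤ c → a ≤ b → c * a ≤ c * b
*-monoˡ-≤ {c} 0≤c a≤b = *-monoˡ-≤-nonNeg c {{nonNegative 0≤c}} a≤b

*-nonNeg : ∀ {a b} → 0ℚ ≤ a → 0ℚ ≤ b → 0ℚ ≤ a * b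
*-nonNeg {a} {b} 0≤a 0≤b = subst (_≤ a * b) (*-zeroʳ a) (*-monoˡ-≤ 0≤a 0≤b)

indicator-⊥ : ∀ {n} (i : Fin n) → indicator ⊥ i ≡ 0ℚ
indicator-⊥ zero    = refl
indicator-⊥ (suc i) = indicator-⊥ i

indicator-∈ : ∀ {n} {i : Fin n} {S} → i ∈ S → indicator S i ≡ 1ℚ
indicator-∈ {i = i} {S} i∈S with i ∈? S
... | yes _  = refl
... | no i∉S = contradiction i∈S i∉S

unitVec-sym : ∀ {n} (i j : Fin n) → unitVec i j ≡ unitVec j i
unitVec-sym zero    zero    = refl
unitVec-sym zero    (suc j) = indicator-⊥ j
unitVec-sym (suc i) zero    = sym (indicator-⊥ i)
unitVec-sym (suc i) (suc j) = unitVec-sym i j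

0≤unitVec : ∀ {n} (i j : Fin n) → 0ℚ ≤ unitVec i j
0≤unitVec i j with does (j ∈? ⁅ i ⁆)
... | true  = nonNegative⁻¹ 1ℚ
... | false = ≤-refl

sum-unitVec : ∀ {n} (i : Fin n) (y : Point n) → sumℚ (λ k → unitVec i k * y k) ≡ y i
sum-unitVec {suc n} zero y = begin
  1ℚ * y zero + sumℚ (λ k → indicator ⊥ k * y (suc k))
    ≡⟨ cong₂ _+_ (*-identityˡ (y zero))
         (sum-cong (λ k → trans (cong (_* y (suc k)) (indicator-⊥ k)) (*-zeroˡ (y (suc k))))) ⟩
  y zero + sumℚ {n} (λ _ → 0ℚ)  ≡⟨ cong (y zero +_) (sum-0 n) ⟩
  y zero + 0ℚ                   ≡⟨ +-identityʳ (y zero) ⟩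
  y zero                        ∎
  where open ≡-Reasoning
sum-unitVec (suc i) y = begin
  0ℚ * y zero + sumℚ (λ k → unitVec i k * y (suc k))
    ≡⟨ cong₂ _+_ (*-zeroˡ (y zero)) (sum-unitVec i (y ∘ suc)) ⟩
  0ℚ + y (suc i)  ≡⟨ +-identityˡ (y (suc i)) ⟩
  y (suc i)       ∎
  where open ≡-Reasoning

weight-cong : ∀ {n} {x y : Point n} → (∀ i → x i ≡ y i) → ∀ S → weight x S ≡ weight y S
weight-cong eq []            = refl
weight-cong eq (outside ∷ S) = weight-cong (eq ∘ suc) S
weight-cong eq (inside ∷ S)  = cong₂ _+_ (eq zero) (weight-cong (eq ∘ suc) S)

weight-+ : ∀ {n} (x y : Point n) S → weight (λ i → x i + y i) S ≡ weight x S + weight y S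
weight-+ x y []            = refl
weight-+ x y (outside ∷ S) = weight-+ (x ∘ suc) (y ∘ suc) S
weight-+ x y (inside ∷ S)  = trans (cong (x zero + y zero +_) (weight-+ (x ∘ suc) (y ∘ suc) S))
  (+-interchange (x zero) (y zero) (weight (x ∘ suc) S) (weight (y ∘ suc) S))

weight-* : ∀ {n} c (x : Point n) S → weight (λ i → c * x i) S ≡ c * weight x S
weight-* c x []            = sym (*-zeroʳ c)
weight-* c x (outside ∷ S) = weight-* c (x ∘ suc) S
weight-* c x (inside ∷ S)  =
  trans (cong (c * x zero +_) (weight-* c (x ∘ suc) S)) (sym (*-distribˡ-+ c (x zero) _))

weight-0 : ∀ {n} (S : Subset n) → weight (λ _ → 0ℚ) S ≡ 0ℚ
weight-0 []            = refl
weight-0 (outside ∷ S) = weight-0 S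
weight-0 (inside ∷ S)  = trans (+-identityˡ _) (weight-0 S)

weight-sum : ∀ {n k} (w : Fin k → ℚ) (v : Fin k → Point n) S →
  weight (λ i → sumℚ (λ j → w j * v j i)) S ≡ sumℚ (λ j → w j * weight (v j) S)
weight-sum {k = zero}  w v S = weight-0 S
weight-sum {k = suc k} w v S = trans
  (weight-+ (λ i → w zero * v zero i) (λ i → sumℚ (λ j → w (suc j) * v (suc j) i)) S)
  (cong₂ _+_ (weight-* (w zero) (v zero) S) (weight-sum (w ∘ suc) (v ∘ suc) S))

weight-⊤ : ∀ {n} (x : Point n) → weight x ⊤ ≡ sumℚ x
weight-⊤ {zero}  x = refl
weight-⊤ {suc n} x = cong (x zero +_) (weight-⊤ (x ∘ suc))

weight-⁅⁆ : ∀ {n} (x : Point n) i → weight x ⁅ i ⁆ ≡ x i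
weight-⁅⁆ x zero    = trans (cong (x zero +_) (weight-⊥ (x ∘ suc))) (+-identityʳ (x zero))
weight-⁅⁆ x (suc i) = weight-⁅⁆ (x ∘ suc) i

weight-∁ : ∀ {n} (x : Point n) S → weight x S + weight x (∁ S) ≡ weight x ⊤
weight-∁ x []            = refl
weight-∁ x (outside ∷ S) = trans
  (solve 3 (λ s x c → s :+ (x :+ c) := x :+ (s :+ c)) refl (weight (x ∘ suc) S) (x zero) (weight (x ∘ suc) (∁ S)))
  (cong (x zero +_) (weight-∁ (x ∘ suc) S))
weight-∁ x (inside ∷ S)  = trans (+-assoc (x zero) _ _) (cong (x zero +_) (weight-∁ (x ∘ suc) S))

weight-unitVec : ∀ {n} (i : Fin n) S → weight (unitVec i) S ≡ indicator S i
weight-unitVec zero    (outside ∷ S) = trans (weight-cong indicator-⊥ S) (weight-0 S)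
weight-unitVec zero    (inside ∷ S)  = cong (1ℚ +_) (trans (weight-cong indicator-⊥ S) (weight-0 S))
weight-unitVec (suc i) (outside ∷ S) = weight-unitVec i S
weight-unitVec (suc i) (inside ∷ S)  = trans (+-identityˡ _) (weight-unitVec i S)

-- Base polytopes of submodular functions

Base : ∀ {n} → SetFun n → PointSet n
Base f x = (∀ S → weight x S ≤ f S) × weight x ⊤ ≡ f ⊤

≐-sym : ∀ {n} {P Q : PointSet n} → P ≐ Q → Q ≐ P
≐-sym P≐Q x = proj₂ (P≐Q x) , proj₁ (P≐Q x)

≐-trans : ∀ {n} {P Q R : PointSet n} → P ≐ Q → Q ≐ R → P ≐ R
≐-trans P≐Q Q≐R x = proj₁ (Q≐R x) ∘ proj₁ (P≐Q x) , proj₂ (P≐Q x) ∘ proj₂ (Q≐R x)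

⊕-cong : ∀ {n} {P P′ Q Q′ : PointSet n} → P ≐ P′ → Q ≐ Q′ → (P ⊕ Q) ≐ (P′ ⊕ Q′)
⊕-cong P≐ Q≐ x =
  (λ { (p , q , Pp , Qq , eq) → p , q , proj₁ (P≐ p) Pp , proj₁ (Q≐ q) Qq , eq }) ,
  (λ { (p , q , Pp , Qq , eq) → p , q , proj₂ (P≐ p) Pp , proj₂ (Q≐ q) Qq , eq })

Base-resp : ∀ {n} {f g : SetFun n} {x y} → (∀ S → f S ≡ g S) → (∀ i → x i ≡ y i) → Base f x → Base g y
Base-resp f≗g x≗y (le , tight) =
  (λ S → subst₂ _≤_ (weight-cong x≗y S) (f≗g S) (le S)) ,
  trans (sym (weight-cong x≗y ⊤)) (trans tight (f≗g ⊤))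

Base-cong : ∀ {n} {f g : SetFun n} → (∀ S → f S ≡ g S) → Base f ≐ Base g
Base-cong f≗g x = Base-resp f≗g (λ _ → refl) , Base-resp (sym ∘ f≗g) (λ _ → refl)

Base-+ : ∀ {n} {f g : SetFun n} {x y} → Base f x → Base g y →
  Base (λ S → f S + g S) (λ i → x i + y i)
Base-+ {x = x} {y} (x≤ , x≡) (y≤ , y≡) =
  (λ S → subst (_≤ _) (sym (weight-+ x y S)) (+-mono-≤ (x≤ S) (y≤ S))) ,
  trans (weight-+ x y ⊤) (cong₂ _+_ x≡ y≡)

Base-* : ∀ {n c} {f : SetFun n} {x} → 0ℚ ≤ c → Base f x → Base (λ S → c * f S) (λ i → c * x i)
Base-* {c = c} {x = x} 0≤c (x≤ , x≡) =
  (λ S → subst (_≤ _) (sym (weight-* c x S)) (*-monoˡ-≤ 0≤c (x≤ S))) ,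
  trans (weight-* c x ⊤) (cong (c *_) x≡)

-- Recovers the tight constraints of both summands at `⊤` from the tight constraint of their sum.
squeeze : ∀ {a b c d} → a ≤ b → c ≤ d → a + c ≡ b + d → a ≡ b × c ≡ d
squeeze {a} {b} {c} {d} a≤b c≤d eq =
  ≤-antisym a≤b (≤-rearrange c≤d (trans (+-comm c a) (trans eq (+-comm b d)))) ,
  ≤-antisym c≤d (≤-rearrange a≤b eq)

≡+- : ∀ a b → a ≡ b + (a - b)
≡+- = solve 2 (λ a b → a := b :+ (a :- b)) refl

-- A `G` that has an element is an additive subgroup of the rationals. Two choices matter: all
-- rationals, which gives the Minkowski sum of base polytopes, and the integers, which gives
-- integral splitting.
module Decomposition (G : ℚ → Set) (G-closed : ∀ {a b} → G a → G b → G (a - b)) where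

  G-0 : ∀ {a} → G a → G 0ℚ
  G-0 {a} Ga = subst G (+-inverseʳ a) (G-closed Ga Ga)

  G-+ : ∀ {a b} → G a → G b → G (a + b)
  G-+ {a} {b} Ga Gb = subst G (solve 2 (λ a b → a :- ((b :- b) :- b) := a :+ b) refl a b)
    (G-closed Ga (G-closed (G-closed Gb Gb) Gb))

  G-mod : ∀ {n} {x : Point n} → (∀ i → G (x i)) → G 0ℚ → ∀ S → G (weight x S)
  G-mod Gx G0 []            = G0
  G-mod Gx G0 (outside ∷ S) = G-mod (Gx ∘ suc) G0 S
  G-mod Gx G0 (inside ∷ S)  = G-+ (Gx zero) (G-mod (Gx ∘ suc) G0 S)

  -- A minimum is one of its two arguments, so fixing a coordinate does not leave `G`.
  G-fix : ∀ {n} {f : SetFun (suc n)} {a} → (∀ S → G (f S)) → G a → ∀ S → G (fix f a S)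
  G-fix {f = f} {a} Gf Ga S with ⊓-sel (f (outside ∷ S)) (f (inside ∷ S) - a)
  ... | inj₁ e = subst G (sym e) (Gf (outside ∷ S))
  ... | inj₂ e = subst G (sym e) (G-closed (Gf (inside ∷ S)) Ga)

  -- Induction on the number of coordinates. Once the first coordinate of `p` is fixed to be `a`,
  -- that of `x - p` is `x zero - a`, and the other coordinates pose the same problem for `fix f a`
  -- and `fix g (x zero - a)`. Only inequalities are carried along; `Base-split` adds tightness.
  decompose : ∀ {n} (x : Point n) (f g : SetFun n) → Submodular f → Submodular g →
    f ⊥ ≡ 0ℚ → g ⊥ ≡ 0ℚ → (∀ S → weight x S ≤ f S + g S) →
    (∀ i → G (x i)) → (∀ S → G (f S)) → (∀ S → G (g S)) →
    ∃ λ p → (∀ i → G (p i)) × (∀ S → weight p S ≤ f S) × (∀ S → weight (λ i → x i - p i) S ≤ g S)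
  decompose {zero} x f g _ _ f⊥ g⊥ _ _ _ _ =
    x , (λ ()) , (λ { [] → ≤-reflexive (sym f⊥) }) , (λ { [] → ≤-reflexive (sym g⊥) })
  decompose {suc n} x f g subf subg f⊥ g⊥ x≤ Gx Gf Gg =
    let p′ , Gp′ , p′≤ , q′≤ = decompose x′ (fix f a) (fix g (x zero - a))
          (fix-submodular f a subf) (fix-submodular g (x zero - a) subg)
          (fix-⊥ f a f⊥ a≤f) (fix-⊥ g (x zero - a) g⊥ x₀-a≤g) x′≤
          (Gx ∘ suc) (G-fix Gf Ga) (G-fix Gg (G-closed (Gx zero) Ga))
    in (λ { zero → a ; (suc i) → p′ i })
     , (λ { zero → Ga ; (suc i) → Gp′ i })
     , (λ { (outside ∷ S) → ≤-trans (p′≤ S) (fix-≤-out f a S)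
          ; (inside ∷ S)  → fix-inside f a S (p′≤ S) })
     , (λ { (outside ∷ S) → ≤-trans (q′≤ S) (fix-≤-out g (x zero - a) S)
          ; (inside ∷ S)  → fix-inside g (x zero - a) S (q′≤ S) })
    where
    x′ = x ∘ suc

    -- The bound on `a` that arises when the minimum for `f` takes its outside branch and the
    -- minimum for `g` its inside branch.
    lower : SetFun n
    lower S = weight x (inside ∷ S) - (f (outside ∷ S) + g (inside ∷ S))

    S* = proj₁ (maximiser lower)

    -- The largest lower bound is admissible, and as a difference of data it lies in `G`.
    a : ℚ
    a = lower S*

    Ga : G a
    Ga = G-closed (G-mod Gx (G-0 (Gf ⊥)) (inside ∷ S*)) (G-+ (Gf _) (Gg _))

    -- The pairs `outside ∷ S`, `inside ∷ T` and `inside ∷ S`, `outside ∷ T` have the same union and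
    -- the same intersection. Modularity of `weight x` moves the second pair to that union and
    -- intersection, where `x≤` applies; submodularity of `f` on the first pair and of `g` on the
    -- second leads back.
    lower≤upper : ∀ S T → lower S ≤ f (inside ∷ T) + g (outside ∷ T) - weight x (outside ∷ T)
    lower≤upper S T = ≤-rearrange
      (≤-trans (≤-reflexive (sym (weight-modular x (inside ∷ S) (outside ∷ T))))
        (≤-trans (+-mono-≤ (x≤ (inside ∷ S ∪ T)) (x≤ (outside ∷ S ∩ T)))
          (≤-trans (≤-reflexive (solve 4 (λ a b c d → (a :+ b) :+ (c :+ d) := (a :+ c) :+ (b :+ d)) refl
                     (f (inside ∷ S ∪ T)) (g (inside ∷ S ∪ T)) (f (outside ∷ S ∩ T)) (g (outside ∷ S ∩ T))))
            (+-mono-≤ (subf (outside ∷ S) (inside ∷ T)) (subg (inside ∷ S) (outside ∷ T))))))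
      (solve 6 (λ s t a b c d → (s :+ t) :+ ((b :+ d) :- t) := ((a :+ b) :+ (c :+ d)) :+ (s :- (a :+ c))) refl
        (weight x (inside ∷ S)) (weight x (outside ∷ T)) (f (outside ∷ S)) (f (inside ∷ T)) (g (inside ∷ S)) (g (outside ∷ T)))

    -- The upper bound at `⊥`; the lower bound at `⊥` gives `x₀-a≤g`. Both keep the new set
    -- functions zero at `⊥`.
    a≤f : a ≤ f (inside ∷ ⊥)
    a≤f = ≤-trans (lower≤upper S* ⊥) (≤-reflexive
      (trans (cong₂ (λ u v → f (inside ∷ ⊥) + u - v) g⊥ (weight-⊥ x′))
        (solve 1 (λ a → (a :+ con 0ℚ) :- con 0ℚ := a) refl (f (inside ∷ ⊥)))))

    x₀-a≤g : x zero - a ≤ g (inside ∷ ⊥)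
    x₀-a≤g = ≤-rearrange (proj₂ (maximiser lower) ⊥)
      (trans (cong₂ (λ u v → x zero + u - (v + g (inside ∷ ⊥)) + g (inside ∷ ⊥)) (weight-⊥ x′) f⊥)
        (solve 3 (λ x g a → ((x :+ con 0ℚ) :- (con 0ℚ :+ g)) :+ g := a :+ (x :- a)) refl (x zero) (g (inside ∷ ⊥)) a))

    -- If both minima take the same branch, `a` cancels and the hypothesis on `x` remains. The two
    -- mixed cases are exactly the lower and the upper bounds on `a`.
    x′≤ : ∀ S → weight x′ S ≤ fix f a S + fix g (x zero - a) S
    x′≤ S with ⊓-sel (f (outside ∷ S)) (f (inside ∷ S) - a)
             | ⊓-sel (g (outside ∷ S)) (g (inside ∷ S) - (x zero - a))
    ... | inj₁ e | inj₁ e′ rewrite e | e′ = x≤ (outside ∷ S)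
    ... | inj₁ e | inj₂ e′ rewrite e | e′ = ≤-rearrange (proj₂ (maximiser lower) S)
      (solve 5 (λ x₀ s f g a → ((x₀ :+ s) :- (f :+ g)) :+ (f :+ (g :- (x₀ :- a))) := a :+ s) refl
        (x zero) (weight x′ S) (f (outside ∷ S)) (g (inside ∷ S)) a)
    ... | inj₂ e | inj₁ e′ rewrite e | e′ = ≤-rearrange (lower≤upper S* S)
      (solve 4 (λ s f g a → a :+ ((f :- a) :+ g) := ((f :+ g) :- s) :+ s) refl
        (weight x′ S) (f (inside ∷ S)) (g (outside ∷ S)) a)
    ... | inj₂ e | inj₂ e′ rewrite e | e′ = ≤-rearrange (x≤ (inside ∷ S))
      (solve 5 (λ x₀ s f g a → (x₀ :+ s) :+ ((f :- a) :+ (g :- (x₀ :- a))) := (f :+ g) :+ s) refl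
        (x zero) (weight x′ S) (f (inside ∷ S)) (g (inside ∷ S)) a)

  Base-split : ∀ {n} {x : Point n} {f g : SetFun n} → Submodular f → Submodular g →
    f ⊥ ≡ 0ℚ → g ⊥ ≡ 0ℚ → Base (λ S → f S + g S) x →
    (∀ i → G (x i)) → (∀ S → G (f S)) → (∀ S → G (g S)) →
    ∃ λ p → (∀ i → G (p i)) × Base f p × Base g (λ i → x i - p i)
  Base-split {x = x} {f} {g} subf subg f⊥ g⊥ (x≤ , x≡) Gx Gf Gg =
    let p , Gp , p≤ , q≤ = decompose x f g subf subg f⊥ g⊥ x≤ Gx Gf Gg
        p≡ , q≡ = squeeze (p≤ ⊤) (q≤ ⊤)
          (trans (sym (weight-+ p (λ i → x i - p i) ⊤)) (trans (sym (weight-cong (λ i → ≡+- (x i) (p i)) ⊤)) x≡))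
    in p , Gp , (p≤ , p≡) , (q≤ , q≡)

-- One inclusion adds the constraints. The other is `Base-split` with `G` all of the rationals.
Base-⊕ : ∀ {n} {f g : SetFun n} → Submodular f → Submodular g → f ⊥ ≡ 0ℚ → g ⊥ ≡ 0ℚ →
  (Base f ⊕ Base g) ≐ Base (λ S → f S + g S)
Base-⊕ subf subg f⊥ g⊥ x =
  (λ { (p , q , Bp , Bq , eq) → Base-resp (λ _ → refl) (sym ∘ eq) (Base-+ Bp Bq) }) ,
  (λ Bx → let p , _ , Bp , Bq = Base-split subf subg f⊥ g⊥ Bx _ _ _
          in p , (λ i → x i - p i) , Bp , Bq , λ i → ≡+- (x i) (p i))
  where open Decomposition (λ _ → Unit) (λ _ _ → tt)

Base-upper : ∀ {n} {f : SetFun n} {x} → Base f x → ∀ i → x i ≤ f ⁅ i ⁆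
Base-upper {x = x} (x≤ , _) i = subst (_≤ _) (weight-⁅⁆ x i) (x≤ ⁅ i ⁆)

-- The tight constraint at `⊤` minus the constraint at `∁ ⁅ i ⁆` bounds `x i` below by
-- `f ⊤ - f (∁ ⁅ i ⁆)`.
Base-lower : ∀ {n} {f : SetFun n} {x} → Base f x → ∀ i → f (∁ ⁅ i ⁆) ≤ f ⊤ → 0ℚ ≤ x i
Base-lower {f = f} {x} (x≤ , x≡) i le =
  ≤-rearrange (≤-trans (x≤ (∁ ⁅ i ⁆)) (≤-trans le (≤-reflexive (sym x≡))))
    (trans (+-comm _ (x i)) (trans (cong (_+ weight x (∁ ⁅ i ⁆)) (sym (weight-⁅⁆ x i)))
      (trans (weight-∁ x ⁅ i ⁆) (sym (+-identityʳ _)))))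

-- Convex combinations and convex hulls

-- Combinations of total weight c, so that Combination 1ℚ L is conv L.
Combination : ∀ {n} → ℚ → List (Point n) → PointSet n
Combination c L x = Σ (Fin (length L) → ℚ) λ w →
  (∀ j → 0ℚ ≤ w j) × (sumℚ w ≡ c) × (∀ i → x i ≡ sumℚ (λ j → w j * lookup L j i))

comb-resp : ∀ {n} (L : List (Point n)) {a b x y} → a ≡ b → (∀ i → x i ≡ y i) →
  Combination a L x → Combination b L y
comb-resp L a≡b x≗y (w , w≥0 , Σw , x≡) = w , w≥0 , trans Σw a≡b , λ i → trans (sym (x≗y i)) (x≡ i)

comb-0 : ∀ {n} (L : List (Point n)) → Combination 0ℚ L (λ _ → 0ℚ)
comb-0 L = (λ _ → 0ℚ) , (λ _ → ≤-refl) , sum-0 (length L) ,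
  λ i → sym (trans (sum-cong (λ j → *-zeroˡ (lookup L j i))) (sum-0 (length L)))

comb-+ : ∀ {n} (L : List (Point n)) {a b x y} → Combination a L x → Combination b L y →
  Combination (a + b) L (λ i → x i + y i)
comb-+ L (w , w≥0 , Σw , x≡) (w′ , w′≥0 , Σw′ , y≡) =
  (λ j → w j + w′ j) , (λ j → +-mono-≤ (w≥0 j) (w′≥0 j)) , trans (sum-+ w w′) (cong₂ _+_ Σw Σw′) ,
  λ i → trans (cong₂ _+_ (x≡ i) (y≡ i)) (trans (sym (sum-+ (λ j → w j * lookup L j i) (λ j → w′ j * lookup L j i)))
    (sum-cong (λ j → sym (*-distribʳ-+ (lookup L j i) (w j) (w′ j)))))

comb-* : ∀ {n} (L : List (Point n)) {a c x} → 0ℚ ≤ c → Combination a L x →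
  Combination (c * a) L (λ i → c * x i)
comb-* L {c = c} 0≤c (w , w≥0 , Σw , x≡) =
  (λ j → c * w j) , (λ j → *-nonNeg 0≤c (w≥0 j)) , trans (sum-* c w) (cong (c *_) Σw) ,
  λ i → trans (cong (c *_) (x≡ i)) (trans (sym (sum-* c (λ j → w j * lookup L j i)))
    (sum-cong (λ j → sym (*-assoc c (w j) (lookup L j i)))))

comb-sum : ∀ {n k} (L : List (Point n)) (c : Fin k → ℚ) (v : Fin k → Point n) →
  (∀ j → Combination (c j) L (v j)) → Combination (sumℚ c) L (λ i → sumℚ (λ j → v j i))
comb-sum {k = zero}  L c v all = comb-0 L
comb-sum {k = suc k} L c v all = comb-+ L (all zero) (comb-sum L (c ∘ suc) (v ∘ suc) (all ∘ suc))

comb-∈ : ∀ {n} {L : List (Point n)} {v} → v ∈ˡ L → Combination 1ℚ L v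
comb-∈ {L = L} {v} v∈L = unitVec j , 0≤unitVec j ,
  trans (trans (sym (weight-⊤ (unitVec j))) (weight-unitVec j ⊤)) (indicator-∈ {i = j} ∈⊤) ,
  λ i → trans (cong (λ u → u i) (lookup-index v∈L)) (sym (sum-unitVec j (λ k → lookup L k i)))
  where
  j = index v∈L

-- The constraints are linear in the point and the weights sum to one, so they pass from the listed
-- points to their averages.
conv⊆Base : ∀ {n} {f : SetFun n} {L} → (∀ {v} → v ∈ˡ L → Base f v) → ∀ {x} → conv L x → Base f x
conv⊆Base {f = f} {L} L⊆ {x} (w , w≥0 , Σw , x≡) = le , tight
  where
  open ≤-Reasoning
  weight-x : ∀ S → weight x S ≡ sumℚ (λ j → w j * weight (lookup L j) S)
  weight-x S = trans (weight-cong x≡ S) (weight-sum w (lookup L) S)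
  average : ∀ c → sumℚ (λ j → w j * c) ≡ c
  average c = trans (sum-cong (λ j → *-comm (w j) c))
    (trans (sum-* c w) (trans (cong (c *_) Σw) (*-identityʳ c)))
  le : ∀ S → weight x S ≤ f S
  le S = begin
    weight x S                                  ≡⟨ weight-x S ⟩
    sumℚ (λ j → w j * weight (lookup L j) S)    ≤⟨ sum-mono (λ j → *-monoˡ-≤ (w≥0 j) (proj₁ (L⊆ (∈-lookup j)) S)) ⟩
    sumℚ (λ j → w j * f S)                   ≡⟨ average (f S) ⟩
    f S                                      ∎
  tight : weight x ⊤ ≡ f ⊤
  tight = trans (weight-x ⊤) (trans (sum-cong (λ j → cong (w j *_) (proj₂ (L⊆ (∈-lookup j))))) (average (f ⊤)))

-- Simplices as base polytopes

-- The maximum over the simplex on ∁ A of the sum of the coordinates in S.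
escapes : ∀ {n} → Subset n → SetFun n
escapes A S = if does (S ⊆? A) then 0ℚ else 1ℚ

escapes-⊆ : ∀ {n} {A S : Subset n} → S ⊆ A → escapes A S ≡ 0ℚ
escapes-⊆ {A = A} {S} S⊆A with S ⊆? A
... | yes _  = refl
... | no S⊈A = contradiction (λ {x} → S⊆A {x}) S⊈A

escapes-⊈ : ∀ {n} {A S : Subset n} {i} → i ∈ S → i ∉ A → escapes A S ≡ 1ℚ
escapes-⊈ {A = A} {S} i∈S i∉A with S ⊆? A
... | yes S⊆A = contradiction (S⊆A i∈S) i∉A
... | no _    = refl

0≤escapes : ∀ {n} (A S : Subset n) → 0ℚ ≤ escapes A S
0≤escapes A S with does (S ⊆? A)
... | true  = ≤-refl
... | false = nonNegative⁻¹ 1ℚ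

escapes≤1 : ∀ {n} (A S : Subset n) → escapes A S ≤ 1ℚ
escapes≤1 A S with does (S ⊆? A)
... | true  = nonNegative⁻¹ 1ℚ
... | false = ≤-refl

escapes-mono : ∀ {n} {A S T : Subset n} → S ⊆ T → escapes A S ≤ escapes A T
escapes-mono {A = A} {S} {T} S⊆T with T ⊆? A
... | yes T⊆A = ≤-reflexive (escapes-⊆ (λ {x} i∈S → T⊆A (S⊆T {x} i∈S)))
... | no _    = escapes≤1 A S

-- If `S` is not inside `A`, its value 1 bounds the union, and `T` bounds the intersection by
-- monotonicity. If `S` is inside `A`, so is the intersection, and the union escapes only if `T`
-- does.
escapes-submodular : ∀ {n} (A : Subset n) → Submodular (escapes A)
escapes-submodular A S T with S ⊆? A
... | no _    = +-mono-≤ (escapes≤1 A (S ∪ T)) (escapes-mono (p∩q⊆q S T))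
... | yes S⊆A with T ⊆? A
...   | no _    = subst (escapes A (S ∪ T) + escapes A (S ∩ T) ≤_) (+-comm 1ℚ 0ℚ)
                    (+-mono-≤ (escapes≤1 A (S ∪ T)) (≤-reflexive (escapes-⊆ (⊆-trans (p∩q⊆p S T) S⊆A))))
...   | yes T⊆A = ≤-reflexive (cong₂ _+_ (escapes-⊆ {A = A} {S ∪ T} ([ S⊆A , T⊆A ]′ ∘ x∈p∪q⁻ S T))
                    (escapes-⊆ (⊆-trans (p∩q⊆p S T) S⊆A)))

simplex⊆Base : ∀ {n} (A : Subset n) {x} → simplex (∁ A) x → Base (escapes A) x
simplex⊆Base {n} A = conv⊆Base vertex
  where
  vertex : ∀ {v} → v ∈ˡ map unitVec (filter (_∈? ∁ A) (allFin n)) → Base (escapes A) v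
  vertex v∈ with ∈-map⁻ unitVec v∈
  ... | i , i∈ , refl = le , trans (weight-unitVec i ⊤)
      (trans (indicator-∈ {i = i} {⊤} ∈⊤) (sym (escapes-⊈ (∈⊤ {x = i}) i∉A)))
    where
    i∉A : i ∉ A
    i∉A = x∈∁p⇒x∉p (proj₂ (∈-filter⁻ (_∈? ∁ A) {xs = allFin n} i∈))
    le : ∀ S → weight (unitVec i) S ≤ escapes A S
    le S rewrite weight-unitVec i S with i ∈? S
    ... | yes i∈S = ≤-reflexive (sym (escapes-⊈ i∈S i∉A))
    ... | no _    = 0≤escapes A S

-- For the converse, a point `x` of the base polytope has nonnegative coordinates, vanishes on `A`,
-- and has coordinate sum `c` because `escapes A ⊤` is 1 for nonempty `∁ A`. Hence `x` is the
-- combination of unit vectors with its own coordinates as coefficients, and division by `c` gives a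
-- point of the simplex.
·-simplex : ∀ {n} {c} (A : Subset n) → 0ℚ < c → Nonempty (∁ A) →
  (c · simplex (∁ A)) ≐ Base (λ S → c * escapes A S)
·-simplex {n} {c} A 0<c (i₀ , i₀∈∁A) x = to , from
  where
  instance
    c-positive : Positive c
    c-positive = positive 0<c
    _ = pos⇒nonZero c

  0≤c : 0ℚ ≤ c
  0≤c = <⇒≤ 0<c

  f : SetFun n
  f S = c * escapes A S

  L : List (Point n)
  L = map unitVec (filter (_∈? ∁ A) (allFin n))

  to : (c · simplex (∁ A)) x → Base f x
  to (q , q∈ , x≡) = Base-resp (λ _ → refl) (sym ∘ x≡) (Base-* 0≤c (simplex⊆Base A q∈))

  from : Base f x → (c · simplex (∁ A)) x
  from Bx = (λ i → 1/ c * x i) , comb-resp L (*-inverseˡ c) (λ _ → refl)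
      (comb-* L 0≤1/c (comb-resp L Σx x≗ (comb-sum L x (λ i j → x i * unitVec i j) part))) ,
      λ i → sym (trans (sym (*-assoc c (1/ c) (x i))) (trans (cong (_* x i) (*-inverseʳ c)) (*-identityˡ (x i))))
    where
    0≤1/c : 0ℚ ≤ 1/ c
    0≤1/c = <⇒≤ (positive⁻¹ (1/ c) {{1/pos⇒pos c}})

    Σx : sumℚ x ≡ c
    Σx = trans (sym (weight-⊤ x)) (trans (proj₂ Bx)
      (trans (cong (c *_) (escapes-⊈ (∈⊤ {x = i₀}) (x∈∁p⇒x∉p i₀∈∁A))) (*-identityʳ c)))

    x≗ : ∀ j → sumℚ (λ i → x i * unitVec i j) ≡ x j
    x≗ j = trans (sum-cong (λ i → trans (*-comm (x i) _) (cong (_* x i) (unitVec-sym i j)))) (sum-unitVec j x)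

    0≤x : ∀ i → 0ℚ ≤ x i
    0≤x i = Base-lower Bx i (*-monoˡ-≤ 0≤c (escapes-mono {A = A} {∁ ⁅ i ⁆} {⊤} (λ _ → ∈⊤)))

    ∈A⇒0 : ∀ {i} → i ∈ A → x i ≡ 0ℚ
    ∈A⇒0 {i} i∈A = ≤-antisym
      (≤-trans (Base-upper Bx i) (≤-reflexive (trans (cong (c *_) (escapes-⊆ ⁅i⁆⊆A)) (*-zeroʳ c))))
      (0≤x i)
      where
      ⁅i⁆⊆A : ⁅ i ⁆ ⊆ A
      ⁅i⁆⊆A j∈ = subst (_∈ A) (sym (x∈⁅y⁆⇒x≡y i j∈)) i∈A

    part : ∀ i → Combination (x i) L (λ j → x i * unitVec i j)
    part i with i ∈? A
    -- The list has no unit vector for `i` in `A`, but the coefficient is zero, so the zero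
    -- combination serves.
    ... | yes i∈A = comb-resp L (sym (∈A⇒0 i∈A))
          (λ j → sym (trans (cong (_* unitVec i j) (∈A⇒0 i∈A)) (*-zeroˡ (unitVec i j)))) (comb-0 L)
    ... | no i∉A  = comb-resp L (*-identityʳ (x i)) (λ _ → refl) (comb-* L (0≤x i)
          (comb-∈ (∈-map⁺ unitVec (∈-filter⁺ (_∈? ∁ A) (∈-allFin i) (x∉p⇒x∈∁p i∉A)))))

-- Minkowski sums of dilated simplices

listSum : ∀ {A : Set} → (A → ℚ) → List A → ℚ
listSum f []       = 0ℚ
listSum f (a ∷ as) = f a + listSum f as

Submodular-+ : ∀ {n} {f g : SetFun n} → Submodular f → Submodular g → Submodular (λ S → f S + g S)
Submodular-+ {f = f} {g} subf subg S T =
  subst₂ _≤_ (+-interchange (f (S ∪ T)) _ _ _) (+-interchange (f S) _ _ _) (+-mono-≤ (subf S T) (subg S T))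

Submodular-* : ∀ {n c} {f : SetFun n} → 0ℚ ≤ c → Submodular f → Submodular (λ S → c * f S)
Submodular-* {c = c} {f} 0≤c subf S T =
  subst₂ _≤_ (*-distribˡ-+ c (f (S ∪ T)) _) (*-distribˡ-+ c (f S) _) (*-monoˡ-≤ 0≤c (subf S T))

module _ {n} (c : Subset n → ℚ) where

  -- Coefficients of either sign are allowed, so that the full signed sum is an instance; positivity
  -- enters with submodularity.
  weighted : List (Subset n) → SetFun n
  weighted L S = listSum (λ A → c A * escapes A S) L

  weighted-⊥ : ∀ L → weighted L ⊥ ≡ 0ℚ
  weighted-⊥ []      = refl
  weighted-⊥ (A ∷ L) = cong₂ _+_ (trans (cong (c A *_) (escapes-⊆ (⊥⊆ {p = A}))) (*-zeroʳ (c A))) (weighted-⊥ L)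

  weighted-submodular : ∀ {L} → All (λ A → 0ℚ < c A × Nonempty (∁ A)) L → Submodular (weighted L)
  weighted-submodular []                 S T = ≤-refl
  weighted-submodular {A ∷ L} ((0<c , _) ∷ ps) =
    Submodular-+ {f = λ S → c A * escapes A S} {g = weighted L}
      (Submodular-* (<⇒≤ 0<c) (escapes-submodular A)) (weighted-submodular ps)

  minkSum≐Base : ∀ {L} → All (λ A → 0ℚ < c A × Nonempty (∁ A)) L →
    minkSum (map (λ A → c A · simplex (∁ A)) L) ≐ Base (weighted L)
  -- The base polytope of the zero function is the origin alone: its upper and lower bounds on every
  -- coordinate are zero.
  minkSum≐Base [] x =
    (λ x≡0 → (λ S → ≤-reflexive (trans (weight-cong x≡0 S) (weight-0 S))) ,
             trans (weight-cong x≡0 ⊤) (weight-0 {n} ⊤)) ,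
    λ Bx i → ≤-antisym (Base-upper Bx i) (Base-lower Bx i ≤-refl)
  minkSum≐Base {A ∷ L} ((0<c , ne) ∷ ps) =
    ≐-trans (⊕-cong (·-simplex A 0<c ne) (minkSum≐Base ps))
      (Base-⊕ (Submodular-* (<⇒≤ 0<c) (escapes-submodular A)) (weighted-submodular ps)
        (trans (cong (c A *_) (escapes-⊆ (⊥⊆ {p = A}))) (*-zeroʳ (c A))) (weighted-⊥ L))

-- Edmonds' theorem: the matroid polytope is the base polytope of the rank function

-- `toℚ` normalises its fraction, so its arithmetic is carried out on unnormalised fractions, where
-- `mkℚᵘ z 0` has denominator 1.
toℚᵘ-toℚ : ∀ z → toℚᵘ (toℚ z) ℚᵘ.≃ mkℚᵘ z 0
toℚᵘ-toℚ z = toℚᵘ-fromℚᵘ (mkℚᵘ z 0)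

toℚ-+ : ∀ a b → toℚ (a ℤ.+ b) ≡ toℚ a + toℚ b
toℚ-+ a b = toℚᵘ-injective (begin
  toℚᵘ (toℚ (a ℤ.+ b))             ≈⟨ toℚᵘ-toℚ (a ℤ.+ b) ⟩
  mkℚᵘ (a ℤ.+ b) 0                 ≈⟨ *≡* (cong (ℤ._* pos 1) (sym (cong₂ ℤ._+_ (ℤ.*-identityʳ a) (ℤ.*-identityʳ b)))) ⟩
  mkℚᵘ a 0 ℚᵘ.+ mkℚᵘ b 0           ≈⟨ ℚᵘ.+-cong (toℚᵘ-toℚ a) (toℚᵘ-toℚ b) ⟨
  toℚᵘ (toℚ a) ℚᵘ.+ toℚᵘ (toℚ b)   ≈⟨ toℚᵘ-homo-+ (toℚ a) (toℚ b) ⟨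
  toℚᵘ (toℚ a + toℚ b)             ∎)
  where open ℚᵘ.≃-Reasoning

toℚ-* : ∀ a b → toℚ (a ℤ.* b) ≡ toℚ a * toℚ b
toℚ-* a b = toℚᵘ-injective (begin
  toℚᵘ (toℚ (a ℤ.* b))             ≈⟨ toℚᵘ-toℚ (a ℤ.* b) ⟩
  mkℚᵘ a 0 ℚᵘ.* mkℚᵘ b 0           ≈⟨ ℚᵘ.*-cong (toℚᵘ-toℚ a) (toℚᵘ-toℚ b) ⟨
  toℚᵘ (toℚ a) ℚᵘ.* toℚᵘ (toℚ b)   ≈⟨ toℚᵘ-homo-* (toℚ a) (toℚ b) ⟨
  toℚᵘ (toℚ a * toℚ b)             ∎)
  where open ℚᵘ.≃-Reasoning

toℚ-neg : ∀ a → toℚ (ℤ.- a) ≡ - toℚ a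
toℚ-neg a = toℚᵘ-injective (begin
  toℚᵘ (toℚ (ℤ.- a))    ≈⟨ toℚᵘ-toℚ (ℤ.- a) ⟩
  ℚᵘ.- mkℚᵘ a 0         ≈⟨ ℚᵘ.-‿cong (toℚᵘ-toℚ a) ⟨
  ℚᵘ.- toℚᵘ (toℚ a)     ≈⟨ toℚᵘ-homo‿- (toℚ a) ⟨
  toℚᵘ (- toℚ a)        ∎)
  where open ℚᵘ.≃-Reasoning

toℚ-mono : ∀ {a b} → a ℤ.≤ b → toℚ a ≤ toℚ b
toℚ-mono {a} {b} a≤b = toℚᵘ-cancel-≤
  (ℚᵘ.≤-respˡ-≃ (ℚᵘ.≃-sym (toℚᵘ-toℚ a)) (ℚᵘ.≤-respʳ-≃ (ℚᵘ.≃-sym (toℚᵘ-toℚ b))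
    (*≤* (subst₂ ℤ._≤_ (sym (ℤ.*-identityʳ a)) (sym (ℤ.*-identityʳ b)) a≤b))))

toℚ-mono-< : ∀ {a b} → a ℤ.< b → toℚ a < toℚ b
toℚ-mono-< {a} {b} a<b = toℚᵘ-cancel-<
  (ℚᵘ.<-respˡ-≃ (ℚᵘ.≃-sym (toℚᵘ-toℚ a)) (ℚᵘ.<-respʳ-≃ (ℚᵘ.≃-sym (toℚᵘ-toℚ b))
    (*<* (subst₂ ℤ._<_ (sym (ℤ.*-identityʳ a)) (sym (ℤ.*-identityʳ b)) a<b))))

toℚ-cancel-≤ : ∀ {a b} → toℚ a ≤ toℚ b → a ℤ.≤ b
toℚ-cancel-≤ {a} {b} le
  with ℚᵘ.≤-respˡ-≃ (toℚᵘ-toℚ a) (ℚᵘ.≤-respʳ-≃ (toℚᵘ-toℚ b) (toℚᵘ-mono-≤ le))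
... | *≤* a≤b = subst₂ ℤ._≤_ (ℤ.*-identityʳ a) (ℤ.*-identityʳ b) a≤b

fromNat : ℕ → ℚ
fromNat k = toℚ (pos k)

fromNat-cancel-≤ : ∀ {a b} → fromNat a ≤ fromNat b → a ℕ.≤ b
fromNat-cancel-≤ = ℤ.drop‿+≤+ ∘ toℚ-cancel-≤

fromNat-mono : ∀ {a b} → a ℕ.≤ b → fromNat a ≤ fromNat b
fromNat-mono = toℚ-mono ∘ ℤ.+≤+

0≤fromNat : ∀ k → 0ℚ ≤ fromNat k
0≤fromNat k = fromNat-mono {0} {k} ℕ.z≤n

Integral : ℚ → Set
Integral q = ∃ λ z → q ≡ toℚ z

Integral-minus : ∀ {a b} → Integral a → Integral b → Integral (a - b)
Integral-minus (z , refl) (z′ , refl) =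
  z ℤ.- z′ , sym (trans (toℚ-+ z (ℤ.- z′)) (cong (toℚ z +_) (toℚ-neg z′)))

Integral-* : ∀ {a b} → Integral a → Integral b → Integral (a * b)
Integral-* (z , refl) (z′ , refl) = z ℤ.* z′ , sym (toℚ-* z z′)

denominator-* : ∀ q → fromNat (↧ₙ q) * q ≡ toℚ (↥ q)
denominator-* q@(mkℚ n d-1 _) = toℚᵘ-injective (begin
  toℚᵘ (fromNat (suc d-1) * q)             ≈⟨ toℚᵘ-homo-* (fromNat (suc d-1)) q ⟩
  toℚᵘ (fromNat (suc d-1)) ℚᵘ.* toℚᵘ q     ≈⟨ ℚᵘ.*-congʳ (toℚᵘ-toℚ (pos (suc d-1))) ⟩
  mkℚᵘ (pos (suc d-1)) 0 ℚᵘ.* mkℚᵘ n d-1       ≈⟨ *≡* cross ⟩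
  mkℚᵘ n 0                                 ≈⟨ toℚᵘ-toℚ n ⟨
  toℚᵘ (toℚ n)                             ∎)
  where
  open ℚᵘ.≃-Reasoning
  -- Denominators are stored minus one, and the product of 1 and `suc d-1` unfolds to
  -- `suc (d-1 ℕ.+ 0)`.
  cross : (pos (suc d-1) ℤ.* n) ℤ.* pos 1 ≡ n ℤ.* pos (suc (d-1 ℕ.+ 0))
  cross = trans (ℤ.*-identityʳ _) (trans (ℤ.*-comm (pos (suc d-1)) n)
    (cong (λ d → n ℤ.* pos (suc d)) (sym (ℕ.+-identityʳ d-1))))

common-denominator : ∀ {n} (x : Point n) →
  ∃ λ N → 0ℚ < fromNat N × (∀ i → Integral (fromNat N * x i))
common-denominator {zero}  x = 1 , positive⁻¹ 1ℚ , λ ()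
common-denominator {suc n} x with common-denominator (x ∘ suc)
... | N , 0<N , int = d ℕ.* N , 0<dN , λ
    { zero    → subst Integral (trans (sym (*-assoc (fromNat N) (fromNat d) (x zero)))
                  (cong (_* x zero) (trans (*-comm (fromNat N) (fromNat d)) dN)))
                  (Integral-* (pos N , refl) (↥ x zero , denominator-* (x zero)))
    ; (suc i) → subst Integral (trans (sym (*-assoc (fromNat d) (fromNat N) (x (suc i)))) (cong (_* x (suc i)) dN))
                  (Integral-* (pos d , refl) (int i)) }
  where
  d = ↧ₙ (x zero)
  dN : fromNat d * fromNat N ≡ fromNat (d ℕ.* N)
  dN = trans (sym (toℚ-* (pos d) (pos N))) (cong toℚ (sym (ℤ.pos-* d N)))
  0<dN : 0ℚ < fromNat (d ℕ.* N)
  0<dN = subst (0ℚ <_) dN (positive⁻¹ _ {{pos*pos⇒pos (fromNat d) {{positive 0<d}} (fromNat N) {{positive 0<N}}}})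
    where
    0<d : 0ℚ < fromNat d
    0<d = toℚ-mono-< {pos 0} {pos d} (ℤ.+<+ (ℕ.s≤s ℕ.z≤n))

∣∩∣+∣∩∁∣ : ∀ {n} (X S : Subset n) → ∣ X ∩ S ∣ ℕ.+ ∣ X ∩ ∁ S ∣ ≡ ∣ X ∣
∣∩∣+∣∩∁∣ []            []            = refl
∣∩∣+∣∩∁∣ (outside ∷ X) (_ ∷ S)       = ∣∩∣+∣∩∁∣ X S
∣∩∣+∣∩∁∣ (inside ∷ X)  (inside ∷ S)  = cong suc (∣∩∣+∣∩∁∣ X S)
∣∩∣+∣∩∁∣ (inside ∷ X)  (outside ∷ S) = trans (ℕ.+-suc _ _) (cong suc (∣∩∣+∣∩∁∣ X S))

weight-indicator : ∀ {n} (X S : Subset n) → weight (indicator X) S ≡ fromNat ∣ X ∩ S ∣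
weight-indicator []            []            = refl
weight-indicator (outside ∷ X) (outside ∷ S) = weight-indicator X S
weight-indicator (outside ∷ X) (inside ∷ S)  = trans (+-identityˡ _) (weight-indicator X S)
weight-indicator (inside ∷ X)  (outside ∷ S) = weight-indicator X S
weight-indicator (inside ∷ X)  (inside ∷ S)  =
  trans (cong (1ℚ +_) (weight-indicator X S)) (sym (toℚ-+ (pos 1) (pos ∣ X ∩ S ∣)))

zero-one : ∀ {q} → Integral q → 0ℚ ≤ q → q ≤ 1ℚ → q ≡ 0ℚ ⊎ q ≡ 1ℚ
zero-one (pos 0 , refl)           _   _   = inj₁ refl
zero-one (pos 1 , refl)           _   _   = inj₂ refl
zero-one (pos (suc (suc k)) , refl) _ q≤1 with toℚ-cancel-≤ {pos (suc (suc k))} {pos 1} q≤1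
... | ℤ.+≤+ (ℕ.s≤s ())
zero-one (-[1+ k ] , refl)      0≤q _   with toℚ-cancel-≤ {pos 0} { -[1+ k ] } 0≤q
... | ()

zero-one-vector : ∀ {n} (p : Point n) → (∀ i → p i ≡ 0ℚ ⊎ p i ≡ 1ℚ) → ∃ λ X → ∀ i → indicator X i ≡ p i
zero-one-vector {zero}  p _ = [] , λ ()
zero-one-vector {suc n} p p01 with zero-one-vector (p ∘ suc) (p01 ∘ suc) | p01 zero
... | X , eq | inj₁ p₀ = outside ∷ X , λ { zero → sym p₀ ; (suc i) → eq i }
... | X , eq | inj₂ p₀ = inside ∷ X , λ { zero → sym p₀ ; (suc i) → eq i }

∈-subsets : ∀ {n} (X : Subset n) → X ∈ˡ subsets n
∈-subsets []            = here refl
∈-subsets (outside ∷ X) = ∈-++⁺ˡ (∈-map⁺ (outside ∷_) (∈-subsets X))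
∈-subsets (inside ∷ X)  = ∈-++⁺ʳ (map (outside ∷_) (subsets _)) (∈-map⁺ (inside ∷_) (∈-subsets X))

module _ {n} (M : Matroid n) where

  rankℚ : SetFun n
  rankℚ S = fromNat (rank M S)

  rank-⊥ : rank M ⊥ ≡ 0
  rank-⊥ = ℕ.n≤0⇒n≡0 (subst (rank M ⊥ ℕ.≤_) (∣⊥∣≡0 n) (rank-bound M ⊥))

  rankℚ-⊥ : rankℚ ⊥ ≡ 0ℚ
  rankℚ-⊥ = cong fromNat rank-⊥

  rankℚ-submodular : Submodular rankℚ
  rankℚ-submodular S T = subst₂ _≤_
    (toℚ-+ (pos (rank M (S ∪ T))) (pos (rank M (S ∩ T))))
    (toℚ-+ (pos (rank M S)) (pos (rank M T)))
    (fromNat-mono (rank-submod M S T))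

  -- Subsets of independent sets are independent: split `B` along `S`, bound the rank of the part
  -- outside `S` by its size, and cancel that size.
  basis-∩-rank : ∀ {B} → IsBasis M B → ∀ S → ∣ B ∩ S ∣ ℕ.≤ rank M S
  basis-∩-rank {B} (indep , _) S = ℕ.≤-trans (ℕ.+-cancelʳ-≤ ∣ B ∩ ∁ S ∣ _ _ (begin
    ∣ B ∩ S ∣ ℕ.+ ∣ B ∩ ∁ S ∣                                  ≡⟨ ∣∩∣+∣∩∁∣ B S ⟩
    ∣ B ∣                                                      ≡⟨ indep ⟨
    rank M B                                                   ≡⟨ cong (rank M) B≡ ⟩
    rank M ((B ∩ S) ∪ (B ∩ ∁ S))                               ≤⟨ ℕ.m≤m+n _ _ ⟩
    rank M ((B ∩ S) ∪ (B ∩ ∁ S)) ℕ.+ rank M ((B ∩ S) ∩ (B ∩ ∁ S))  ≤⟨ rank-submod M (B ∩ S) (B ∩ ∁ S) ⟩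
    rank M (B ∩ S) ℕ.+ rank M (B ∩ ∁ S)                        ≤⟨ ℕ.+-monoʳ-≤ (rank M (B ∩ S)) (rank-bound M (B ∩ ∁ S)) ⟩
    rank M (B ∩ S) ℕ.+ ∣ B ∩ ∁ S ∣                             ∎))
    (rank-mono M (B ∩ S) S (p∩q⊆q B S))
    where
    open ℕ.≤-Reasoning
    B≡ : B ≡ (B ∩ S) ∪ (B ∩ ∁ S)
    B≡ = trans (sym (∩-identityʳ B)) (trans (cong (B ∩_) (sym (p∪∁p≡⊤ S))) (∩-distribˡ-∪ B S (∁ S)))

  basis⇒Base : ∀ {B} → IsBasis M B → Base rankℚ (indicator B)
  basis⇒Base {B} basis@(indep , spans) =
    (λ S → subst (_≤ rankℚ S) (sym (weight-indicator B S)) (fromNat-mono (basis-∩-rank basis S))) ,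
    trans (weight-indicator B ⊤) (cong fromNat (trans (cong ∣_∣ (∩-identityʳ B)) (trans (sym indep) spans)))

  -- The constraint at `X` itself gives independence, and the tight constraint at `⊤` gives full
  -- rank.
  Base⇒basis : ∀ {X} → Base rankℚ (indicator X) → IsBasis M X
  Base⇒basis {X} (X≤ , X≡) = indep , trans indep spans
    where
    indep : rank M X ≡ ∣ X ∣
    indep = ℕ.≤-antisym (rank-bound M X) (fromNat-cancel-≤
      (subst (_≤ rankℚ X) (trans (weight-indicator X X) (cong (fromNat ∘ ∣_∣) (∩-idem X))) (X≤ X)))
    spans : ∣ X ∣ ≡ rank M ⊤
    spans = ℕ.≤-antisym (fromNat-cancel-≤ (≤-reflexive eq)) (fromNat-cancel-≤ (≤-reflexive (sym eq)))
      where
      eq : fromNat ∣ X ∣ ≡ rankℚ ⊤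
      eq = trans (cong (fromNat ∘ ∣_∣) (sym (∩-identityʳ X))) (trans (sym (weight-indicator X ⊤)) X≡)

  vertices : List (Point n)
  vertices = map indicator (bases M)

  -- Singletons have rank at most 1 and the rank is monotone, so all coordinates lie between 0 and
  -- 1. Being integral, they form an indicator vector, and `Base⇒basis` applies.
  integral-vertex : ∀ {p} → (∀ i → Integral (p i)) → Base rankℚ p → Combination 1ℚ vertices p
  integral-vertex {p} int Bp = comb-resp vertices refl X≗ (comb-∈
      (∈-map⁺ indicator (∈-filter⁺ (isBasis? M) (∈-subsets X)
        (Base⇒basis (Base-resp (λ _ → refl) (sym ∘ X≗) Bp)))))
    where
    p≤1 : ∀ i → p i ≤ 1ℚ
    p≤1 i = ≤-trans (Base-upper Bp i) (fromNat-mono (subst (rank M ⁅ i ⁆ ℕ.≤_) (∣⁅x⁆∣≡1 i) (rank-bound M ⁅ i ⁆)))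
    0≤p : ∀ i → 0ℚ ≤ p i
    0≤p i = Base-lower Bp i (fromNat-mono (rank-mono M (∁ ⁅ i ⁆) ⊤ (λ _ → ∈⊤)))
    X∃ = zero-one-vector p (λ i → zero-one (int i) (0≤p i) (p≤1 i))
    X = proj₁ X∃
    X≗ = proj₂ X∃

  open Decomposition Integral Integral-minus using (Base-split)

  -- Each step splits one integral point of `Base rankℚ` off `y`, by `Base-split` over the integers,
  -- and the difference stays integral. For `N = 0` the bounds force `y` to be zero.
  integral-combination : ∀ N {y} → (∀ i → Integral (y i)) →
    Base (λ S → fromNat N * rankℚ S) y → Combination (fromNat N) vertices y
  integral-combination zero {y} int By = comb-resp vertices refl
    (λ i → ≤-antisym
      (Base-lower By i (≤-reflexive (trans (*-zeroˡ (rankℚ (∁ ⁅ i ⁆))) (sym (*-zeroˡ (rankℚ ⊤))))))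
      (≤-trans (Base-upper By i) (≤-reflexive (*-zeroˡ (rankℚ ⁅ i ⁆)))))
    (comb-0 vertices)
  integral-combination (suc N) {y} int By =
    let p , p-int , Bp , Bq = Base-split rankℚ-submodular
          (Submodular-* {f = rankℚ} (0≤fromNat N) rankℚ-submodular) rankℚ-⊥
          (trans (cong (fromNat N *_) rankℚ-⊥) (*-zeroʳ (fromNat N)))
          (Base-resp step (λ _ → refl) By)
          int (λ S → pos (rank M S) , refl) (λ S → Integral-* (pos N , refl) (pos (rank M S) , refl))
    in comb-resp vertices (sym suc-N) (λ i → sym (≡+- (y i) (p i)))
         (comb-+ vertices (integral-vertex p-int Bp)
           (integral-combination N (λ i → Integral-minus (int i) (p-int i)) Bq))
    where
    suc-N : fromNat (suc N) ≡ 1ℚ + fromNat N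
    suc-N = toℚ-+ (pos 1) (pos N)
    step : ∀ S → fromNat (suc N) * rankℚ S ≡ rankℚ S + fromNat N * rankℚ S
    step S = trans (cong (_* rankℚ S) suc-N) (trans (*-distribʳ-+ (rankℚ S) 1ℚ (fromNat N))
      (cong (_+ fromNat N * rankℚ S) (*-identityˡ (rankℚ S))))

  matroidPolytope≐Base : matroidPolytope M ≐ Base rankℚ
  matroidPolytope≐Base x = conv⊆Base vertex , from
    where
    vertex : ∀ {v} → v ∈ˡ vertices → Base rankℚ v
    vertex v∈ with ∈-map⁻ indicator v∈
    ... | B , B∈ , refl = basis⇒Base (proj₂ (∈-filter⁻ (isBasis? M) {xs = subsets n} B∈))

    from : Base rankℚ x → matroidPolytope M x
    from Bx with common-denominator x
    -- Scaling by the common denominator makes `x` integral; the combination of total weight `N`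
    -- found there is scaled back by `1/ N′`.
    ... | N , 0<N , int = comb-resp vertices (*-inverseˡ N′)
        (λ i → trans (sym (*-assoc (1/ N′) N′ (x i))) (trans (cong (_* x i) (*-inverseˡ N′)) (*-identityˡ (x i))))
        (comb-* vertices (<⇒≤ (positive⁻¹ (1/ N′) {{1/pos⇒pos N′}}))
          (integral-combination N int (Base-* (<⇒≤ 0<N) Bx)))
      where
      N′ = fromNat N
      instance
        N-positive : Positive N′
        N-positive = positive 0<N
        N-nonZero : NonZero N′
        N-nonZero = pos⇒nonZero N′

-- Möbius inversion of the rank function

-- The recursion follows that of `mobius`, so identities can be proved one element at a time;
-- `sumℤ-subsets` links it to the list `subsets n`.
subsetSum : ∀ {n} → (Subset n → ℤ) → ℤ
subsetSum {zero}  F = F []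
subsetSum {suc n} F = subsetSum (F ∘ (outside ∷_)) ℤ.+ subsetSum (F ∘ (inside ∷_))

subsetSum-cong : ∀ {n} {F G : Subset n → ℤ} → (∀ X → F X ≡ G X) → subsetSum F ≡ subsetSum G
subsetSum-cong {zero}  eq = eq []
subsetSum-cong {suc n} eq = cong₂ ℤ._+_ (subsetSum-cong (eq ∘ (outside ∷_))) (subsetSum-cong (eq ∘ (inside ∷_)))

subsetSum-0 : ∀ n → subsetSum {n} (λ _ → 0ℤ) ≡ 0ℤ
subsetSum-0 zero    = refl
subsetSum-0 (suc n) = cong₂ ℤ._+_ (subsetSum-0 n) (subsetSum-0 n)

subsetSum-minus : ∀ {n} (F G : Subset n → ℤ) → subsetSum (λ X → F X ℤ.- G X) ≡ subsetSum F ℤ.- subsetSum G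
subsetSum-minus {zero}  F G = refl
subsetSum-minus {suc n} F G = trans (cong₂ ℤ._+_ (subsetSum-minus (F ∘ (outside ∷_)) _) (subsetSum-minus (F ∘ (inside ∷_)) _))
  (ℤS.solve 4 (λ a b c d → (a ℤS.:- b) ℤS.:+ (c ℤS.:- d) ℤS.:= (a ℤS.:+ c) ℤS.:- (b ℤS.:+ d)) refl
    (subsetSum (F ∘ (outside ∷_))) (subsetSum (G ∘ (outside ∷_))) (subsetSum (F ∘ (inside ∷_))) (subsetSum (G ∘ (inside ∷_))))

sumℤ-++ : ∀ xs ys → sumℤ (xs ++ ys) ≡ sumℤ xs ℤ.+ sumℤ ys
sumℤ-++ []       ys = sym (ℤ.+-identityˡ (sumℤ ys))
sumℤ-++ (x ∷ xs) ys = trans (cong (λ s → x ℤ.+ s) (sumℤ-++ xs ys)) (sym (ℤ.+-assoc x (sumℤ xs) (sumℤ ys)))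

sumℤ-subsets : ∀ {n} (F : Subset n → ℤ) → sumℤ (map F (subsets n)) ≡ subsetSum F
sumℤ-subsets {zero}  F = ℤ.+-identityʳ (F [])
sumℤ-subsets {suc n} F = begin
  sumℤ (map F (map (outside ∷_) (subsets n) ++ map (inside ∷_) (subsets n)))
    ≡⟨ cong sumℤ (map-++ F (map (outside ∷_) (subsets n)) (map (inside ∷_) (subsets n))) ⟩
  sumℤ (map F (map (outside ∷_) (subsets n)) ++ map F (map (inside ∷_) (subsets n)))
    ≡⟨ sumℤ-++ (map F (map (outside ∷_) (subsets n))) _ ⟩
  sumℤ (map F (map (outside ∷_) (subsets n))) ℤ.+ sumℤ (map F (map (inside ∷_) (subsets n)))
    ≡⟨ cong₂ ℤ._+_ (cong sumℤ (sym (map-∘ (subsets n)))) (cong sumℤ (sym (map-∘ (subsets n)))) ⟩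
  sumℤ (map (F ∘ (outside ∷_)) (subsets n)) ℤ.+ sumℤ (map (F ∘ (inside ∷_)) (subsets n))
    ≡⟨ cong₂ ℤ._+_ (sumℤ-subsets (F ∘ (outside ∷_))) (sumℤ-subsets (F ∘ (inside ∷_))) ⟩
  subsetSum F ∎
  where open ≡-Reasoning

sumℤ-filter : ∀ {A : Set} {P : A → Set} (P? : Decidable P) (F : A → ℤ) xs →
  sumℤ (map F (filter P? xs)) ≡ sumℤ (map (λ x → if does (P? x) then F x else 0ℤ) xs)
sumℤ-filter P? F []       = refl
sumℤ-filter P? F (x ∷ xs) with does (P? x)
... | true  = cong (λ s → F x ℤ.+ s) (sumℤ-filter P? F xs)
... | false = trans (sumℤ-filter P? F xs) (sym (ℤ.+-identityˡ _))

-- mobius F A = Σ_{Y ⊇ A} (-1)^|Y − A| F Y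
mobius : ∀ {n} → (Subset n → ℤ) → Subset n → ℤ
mobius F []            = F []
mobius F (inside ∷ A)  = mobius (F ∘ (inside ∷_)) A
mobius F (outside ∷ A) = mobius (F ∘ (outside ∷_)) A ℤ.- mobius (F ∘ (inside ∷_)) A

-- The supersets of `A` are the `X ∪ A` with `X` inside `∁ A`. An element of `A` rules out half of
-- the `X`; any other element flips the sign when it joins `X`.
mobius-alternating : ∀ {n} (F : Subset n → ℤ) A →
  subsetSum (λ X → if does (X ⊆? ∁ A) then negOnePow ∣ X ∣ ℤ.* F (X ∪ A) else 0ℤ) ≡ mobius F A
mobius-alternating F []           = ℤ.*-identityˡ (F [])
mobius-alternating {suc n} F (inside ∷ A) =
  trans (cong₂ ℤ._+_ (mobius-alternating (F ∘ (inside ∷_)) A) (subsetSum-0 n)) (ℤ.+-identityʳ _)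
mobius-alternating {suc n} F (outside ∷ A) = begin
  subsetSum (term outside) ℤ.+
  subsetSum (λ X → if does (X ⊆? ∁ A) then (ℤ.- negOnePow ∣ X ∣) ℤ.* F (inside ∷ (X ∪ A)) else 0ℤ)
    ≡⟨ cong (λ s → subsetSum (term outside) ℤ.+ s) (subsetSum-cong flip) ⟩
  subsetSum (term outside) ℤ.+ subsetSum (λ X → 0ℤ ℤ.- term inside X)
    ≡⟨ cong (λ s → subsetSum (term outside) ℤ.+ s) (trans (subsetSum-minus {n} (λ _ → 0ℤ) (term inside))
         (trans (cong (λ z → z ℤ.- subsetSum (term inside)) (subsetSum-0 n)) (ℤ.+-identityˡ _))) ⟩
  subsetSum (term outside) ℤ.- subsetSum (term inside)
    ≡⟨ cong₂ ℤ._-_ (mobius-alternating (F ∘ (outside ∷_)) A) (mobius-alternating (F ∘ (inside ∷_)) A) ⟩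
  mobius (F ∘ (outside ∷_)) A ℤ.- mobius (F ∘ (inside ∷_)) A ∎
  where
  open ≡-Reasoning
  term : _ → Subset n → ℤ
  term b X = if does (X ⊆? ∁ A) then negOnePow ∣ X ∣ ℤ.* F (b ∷ (X ∪ A)) else 0ℤ
  flip : ∀ X → (if does (X ⊆? ∁ A) then (ℤ.- negOnePow ∣ X ∣) ℤ.* F (inside ∷ (X ∪ A)) else 0ℤ)
    ≡ 0ℤ ℤ.- term inside X
  flip X with does (X ⊆? ∁ A)
  ... | true  = trans (sym (ℤ.neg-distribˡ-* (negOnePow ∣ X ∣) _)) (sym (ℤ.+-identityˡ _))
  ... | false = refl

-+-cancel : ∀ a b → (a ℤ.- b) ℤ.+ b ≡ a
-+-cancel a b = trans (ℤ.+-assoc a (ℤ.- b) b) (trans (cong (λ s → a ℤ.+ s) (ℤ.+-inverseˡ b)) (ℤ.+-identityʳ a))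

-- An element of `S` must lie in `A`, so half of the sum vanishes. For an element outside `S`, the
-- term subtracted for `A` without it is the one added for `A` with it, and the sum telescopes.
mobius-inversion : ∀ {n} (F : Subset n → ℤ) S →
  subsetSum (λ A → if does (S ⊆? A) then mobius F A else 0ℤ) ≡ F S
mobius-inversion F [] = refl
mobius-inversion {suc n} F (inside ∷ S) =
  trans (cong₂ ℤ._+_ (subsetSum-0 n) (mobius-inversion (F ∘ (inside ∷_)) S)) (ℤ.+-identityˡ (F (inside ∷ S)))
mobius-inversion {suc n} F (outside ∷ S) = begin
  subsetSum (λ A → if does (S ⊆? A) then mobius (F ∘ (outside ∷_)) A ℤ.- mobius (F ∘ (inside ∷_)) A else 0ℤ)
    ℤ.+ subsetSum (term inside)
    ≡⟨ cong (λ s → s ℤ.+ subsetSum (term inside)) (trans (subsetSum-cong distrib) (subsetSum-minus (term outside) (term inside))) ⟩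
  (subsetSum (term outside) ℤ.- subsetSum (term inside)) ℤ.+ subsetSum (term inside)
    ≡⟨ -+-cancel (subsetSum (term outside)) (subsetSum (term inside)) ⟩
  subsetSum (term outside)
    ≡⟨ mobius-inversion (F ∘ (outside ∷_)) S ⟩
  F (outside ∷ S) ∎
  where
  open ≡-Reasoning
  term : _ → Subset n → ℤ
  term b A = if does (S ⊆? A) then mobius (F ∘ (b ∷_)) A else 0ℤ
  distrib : ∀ A → (if does (S ⊆? A) then mobius (F ∘ (outside ∷_)) A ℤ.- mobius (F ∘ (inside ∷_)) A else 0ℤ)
    ≡ term outside A ℤ.- term inside A
  distrib A with does (S ⊆? A)
  ... | true  = refl
  ... | false = refl

-- The inversion formula at `⊥`, where every `A` counts, by the same telescoping.
subsetSum-mobius : ∀ {n} (F : Subset n → ℤ) → subsetSum (mobius F) ≡ F ⊥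
subsetSum-mobius {zero}  F = refl
subsetSum-mobius {suc n} F = begin
  subsetSum (λ A → mobius F₀ A ℤ.- mobius F₁ A) ℤ.+ subsetSum (mobius F₁)
    ≡⟨ cong (λ s → s ℤ.+ subsetSum (mobius F₁)) (subsetSum-minus (mobius F₀) (mobius F₁)) ⟩
  (subsetSum (mobius F₀) ℤ.- subsetSum (mobius F₁)) ℤ.+ subsetSum (mobius F₁)
    ≡⟨ -+-cancel (subsetSum (mobius F₀)) (subsetSum (mobius F₁)) ⟩
  subsetSum (mobius F₀)  ≡⟨ subsetSum-mobius F₀ ⟩
  F ⊥             ∎
  where
  open ≡-Reasoning
  F₀ = F ∘ (outside ∷_)
  F₁ = F ∘ (inside ∷_)

mobius-⊤ : ∀ {n} (F : Subset n → ℤ) → mobius F ⊤ ≡ F ⊤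
mobius-⊤ {zero}  F = refl
mobius-⊤ {suc n} F = mobius-⊤ (F ∘ (inside ∷_))

-- A set `S` not inside `A` shows that `A` is not `⊤`. At an element outside `A` the two branches of
-- `mobius` carry the same contribution of the constant `c`, and it cancels.
mobius-shift : ∀ {n} (F : Subset n → ℤ) c S A → does (S ⊆? A) ≡ false →
  mobius (λ X → F X ℤ.- c) A ≡ mobius F A
mobius-shift F c [] [] ()
mobius-shift F c (outside ∷ S) (inside ∷ A) S⊈A = mobius-shift (F ∘ (inside ∷_)) c S A S⊈A
mobius-shift F c (inside ∷ S)  (inside ∷ A) S⊈A = mobius-shift (F ∘ (inside ∷_)) c S A S⊈A
mobius-shift F c (_ ∷ _) (outside ∷ A) _ = trans
  (cong₂ ℤ._-_ (mobius-minus (F ∘ (outside ∷_)) A) (mobius-minus (F ∘ (inside ∷_)) A))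
  (ℤS.solve 3 (λ a b d → (a ℤS.:- d) ℤS.:- (b ℤS.:- d) ℤS.:= a ℤS.:- b) refl
    (mobius (F ∘ (outside ∷_)) A) (mobius (F ∘ (inside ∷_)) A) (mobius (λ _ → c) A))
  where
  mobius-minus : ∀ {n} (F : Subset n → ℤ) A → mobius (λ X → F X ℤ.- c) A ≡ mobius F A ℤ.- mobius (λ _ → c) A
  mobius-minus F []            = refl
  mobius-minus F (inside ∷ A)  = mobius-minus (F ∘ (inside ∷_)) A
  mobius-minus F (outside ∷ A) = trans
    (cong₂ ℤ._-_ (mobius-minus (F ∘ (outside ∷_)) A) (mobius-minus (F ∘ (inside ∷_)) A))
    (ℤS.solve 3 (λ a b d → (a ℤS.:- d) ℤS.:- (b ℤS.:- d) ℤS.:= (a ℤS.:- b) ℤS.:- (d ℤS.:- d)) refl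
      (mobius (F ∘ (outside ∷_)) A) (mobius (F ∘ (inside ∷_)) A) (mobius (λ _ → c) A))

negOnePow-cancel : ∀ k s → negOnePow (suc k) ℤ.* (negOnePow k ℤ.* s) ≡ ℤ.- s
negOnePow-cancel zero    s = trans (ℤ.-1*i≡-i _) (cong ℤ.-_ (ℤ.*-identityˡ s))
negOnePow-cancel (suc k) s = trans
  (ℤS.solve 2 (λ a s → ℤS.:- (ℤS.:- a) ℤS.:* (ℤS.:- a ℤS.:* s) ℤS.:= ℤS.:- a ℤS.:* (a ℤS.:* s)) refl (negOnePow k) s)
  (negOnePow-cancel k s)

listSum-toℚ : ∀ {A : Set} {g : A → ℚ} {h : A → ℤ} → (∀ a → g a ≡ toℚ (h a)) →
  ∀ as → listSum g as ≡ toℚ (sumℤ (map h as))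
listSum-toℚ g≗h []      = refl
listSum-toℚ {h = h} g≗h (a ∷ as) = trans (cong₂ _+_ (g≗h a) (listSum-toℚ g≗h as)) (sym (toℚ-+ (h a) (sumℤ (map h as))))

-- Signed beta invariants as coefficients of the rank function

module _ {n} (M : Matroid n) where

  rankℤ : Subset n → ℤ
  rankℤ S = pos (rank M S)

  -- The sign powers in `beta` and `signedBetaContr` multiply to -1. The constant `rankℤ A` from the
  -- contraction is kept: it makes the value at `⊤` zero, and `mobius-shift` removes it where some
  -- set is not inside `A`.
  signedBeta-mobius : ∀ A → signedBetaContr M A ≡ ℤ.- mobius (λ X → rankℤ X ℤ.- rankℤ A) A
  signedBeta-mobius A = trans (negOnePow-cancel (contrTotalRank M A) _) (cong ℤ.-_
    (trans (sumℤ-filter (_⊆? ∁ A) (λ X → negOnePow ∣ X ∣ ℤ.* contrRank M A X) (subsets n)) (trans (sumℤ-subsets {n} _)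
      (mobius-alternating (λ X → rankℤ X ℤ.- rankℤ A) A))))

  signedBeta-⊤ : signedBetaContr M ⊤ ≡ 0ℤ
  signedBeta-⊤ = trans (signedBeta-mobius ⊤) (cong ℤ.-_
    (trans (mobius-⊤ (λ X → rankℤ X ℤ.- rankℤ ⊤)) (ℤ.+-inverseʳ (rankℤ ⊤))))

  -- Only `⊤` has empty complement, and its coefficient is zero. Hence every simplex that occurs in
  -- the Minkowski sums is nonempty, as `·-simplex` requires.
  signedBeta-nonempty : ∀ A → signedBetaContr M A ≢ 0ℤ → Nonempty (∁ A)
  signedBeta-nonempty A β≢0 with nonempty? (∁ A)
  ... | yes ne   = ne
  ... | no empty = contradiction (trans (cong (signedBetaContr M) A≡⊤) signedBeta-⊤) β≢0
    where
    A≡⊤ : A ≡ ⊤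
    A≡⊤ = trans (sym (∪-identityʳ A)) (trans (cong (A ∪_) (sym (Empty-unique empty))) (p∪∁p≡⊤ A))

  -- Where `S` is not inside `A` the coefficient is minus the Möbius transform of the rank. Summing
  -- over those `A` gives the sum over `A` containing `S` minus the sum over all `A`, that is, the
  -- rank of `S` minus the rank of `⊥`.
  rank-expansion : ∀ S → subsetSum (λ A → if does (S ⊆? A) then 0ℤ else signedBetaContr M A) ≡ rankℤ S
  rank-expansion S = begin
    subsetSum (λ A → if does (S ⊆? A) then 0ℤ else signedBetaContr M A)   ≡⟨ subsetSum-cong term ⟩
    subsetSum (λ A → above A ℤ.- mobius rankℤ A)                          ≡⟨ subsetSum-minus above (mobius rankℤ) ⟩
    subsetSum above ℤ.- subsetSum (mobius rankℤ)                                 ≡⟨ cong₂ ℤ._-_ (mobius-inversion rankℤ S) (subsetSum-mobius rankℤ) ⟩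
    rankℤ S ℤ.- rankℤ ⊥                                            ≡⟨ cong (λ k → rankℤ S ℤ.- pos k) (rank-⊥ M) ⟩
    rankℤ S ℤ.- 0ℤ                                                 ≡⟨ ℤ.+-identityʳ (rankℤ S) ⟩
    rankℤ S                                                        ∎
    where
    open ≡-Reasoning
    above : Subset n → ℤ
    above A = if does (S ⊆? A) then mobius rankℤ A else 0ℤ
    term : ∀ A → (if does (S ⊆? A) then 0ℤ else signedBetaContr M A) ≡ above A ℤ.- mobius rankℤ A
    term A with does (S ⊆? A) in eq
    ... | true  = sym (ℤ.+-inverseʳ (mobius rankℤ A))
    ... | false = trans (signedBeta-mobius A)
      (trans (cong ℤ.-_ (mobius-shift rankℤ (rankℤ A) S A eq)) (sym (ℤ.+-identityˡ _)))

  positive? : Decidable (λ A → 0ℤ ℤ.< signedBetaContr M A)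
  positive? A = 0ℤ ℤ.<? signedBetaContr M A

  negative? : Decidable (λ A → signedBetaContr M A ℤ.< 0ℤ)
  negative? A = signedBetaContr M A ℤ.<? 0ℤ

  β β⁻ : Subset n → ℚ
  β  A = toℚ (signedBetaContr M A)
  β⁻ A = toℚ (ℤ.- signedBetaContr M A)

  -- Term by term: a negative coefficient cancels against its opposite, a zero one contributes
  -- nothing, a positive one stays. The other combinations of trichotomy and filter tests are
  -- contradictory.
  weighted-signs : ∀ L S → weighted β L S + weighted β⁻ (filter negative? L) S ≡ weighted β (filter positive? L) S
  weighted-signs []      S = refl
  weighted-signs (A ∷ L) S with ℤ.<-cmp (signedBetaContr M A) 0ℤ | negative? A | positive? A
  ... | tri< lt _ _ | no ¬lt | _      = contradiction lt ¬lt
  ... | tri< _ _ ¬gt | _     | yes gt = contradiction gt ¬gt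
  ... | tri< _ _ _  | yes _  | no _   = trans
    (trans (cong (λ b → β A * escapes A S + weighted β L S + (b * escapes A S + weighted β⁻ (filter negative? L) S))
        (toℚ-neg (signedBetaContr M A)))
      (solve 4 (λ b e x y → ((b :* e) :+ x) :+ ((:- b :* e) :+ y) := x :+ y) refl
        (β A) (escapes A S) (weighted β L S) (weighted β⁻ (filter negative? L) S)))
    (weighted-signs L S)
  ... | tri≈ ¬lt _ _ | yes lt | _      = contradiction lt ¬lt
  ... | tri≈ _ _ ¬gt | _      | yes gt = contradiction gt ¬gt
  ... | tri≈ _ eq _  | no _   | no _   = trans (cong (_+ weighted β⁻ (filter negative? L) S)
      (trans (cong (λ b → toℚ b * escapes A S + weighted β L S) eq)
        (trans (cong (_+ weighted β L S) (*-zeroˡ (escapes A S))) (+-identityˡ (weighted β L S)))))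
    (weighted-signs L S)
  ... | tri> ¬lt _ _ | yes lt | _      = contradiction lt ¬lt
  ... | tri> _ _ gt  | _      | no ¬gt = contradiction gt ¬gt
  ... | tri> _ _ _   | no _   | yes _  = trans (+-assoc (β A * escapes A S) _ _)
    (cong (β A * escapes A S +_) (weighted-signs L S))

  weighted-subsets : ∀ S → weighted β (subsets n) S ≡ rankℚ M S
  weighted-subsets S = trans (listSum-toℚ term (subsets n))
    (cong toℚ (trans (sumℤ-subsets (λ A → if does (S ⊆? A) then 0ℤ else signedBetaContr M A)) (rank-expansion S)))
    where
    term : ∀ A → β A * escapes A S ≡ toℚ (if does (S ⊆? A) then 0ℤ else signedBetaContr M A)
    term A with does (S ⊆? A)
    ... | true  = *-zeroʳ (β A)
    ... | false = *-identityʳ (β A)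

  negatives : All (λ A → 0ℚ < β⁻ A × Nonempty (∁ A)) (filter negative? (subsets n))
  negatives = All.map
    (λ {A} lt → toℚ-mono-< {pos 0} {ℤ.- signedBetaContr M A} (ℤ.neg-mono-< lt) , signedBeta-nonempty A (ℤ.<⇒≢ lt))
    (all-filter negative? (subsets n))

  positives : All (λ A → 0ℚ < β A × Nonempty (∁ A)) (filter positive? (subsets n))
  positives = All.map
    (λ {A} gt → toℚ-mono-< {pos 0} {signedBetaContr M A} gt , signedBeta-nonempty A (≢-sym (ℤ.<⇒≢ gt)))
    (all-filter positive? (subsets n))

theorem2p5 : (n : ℕ) (M : Matroid n) →
    (matroidPolytope M ⊕ negativePart M) ≐ positivePart M
theorem2p5 n M =
  ≐-trans (⊕-cong (matroidPolytope≐Base M) (minkSum≐Base (β⁻ M) (negatives M)))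
    (≐-trans (Base-⊕ (rankℚ-submodular M) (weighted-submodular (β⁻ M) (negatives M)) (rankℚ-⊥ M)
        (weighted-⊥ (β⁻ M) L⁻))
      (≐-trans (Base-cong compare) (≐-sym (minkSum≐Base (β M) (positives M)))))
  where
  L⁻ = filter (negative? M) (subsets n)
  L⁺ = filter (positive? M) (subsets n)
  compare : ∀ S → rankℚ M S + weighted (β⁻ M) L⁻ S ≡ weighted (β M) L⁺ S
  -- Once the rank is written as the signed sum over all subsets, adding the negative part cancels
  -- its negative terms.
  compare S = trans (cong (_+ weighted (β⁻ M) L⁻ S) (sym (weighted-subsets M S)))
    (weighted-signs M (subsets n) S)
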